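{- Let $\gamma/\lambda$ be a skew shape with $n$ rows and $k$ columns. If $\mu=(\mu_1,\mu_2,\ldots)$ is a partition with $c^{\gamma}_{\lambda,\mu}\neq0$, then $$(\mu_1,\mu_2,\ldots)\le_{GDom}\partial^{(0)}(\gamma/\lambda),$$ and for all $1\le j\le n$ and all sequences $1\le i_1<\cdots<i_j\le n$, $$(\mu_{j+1},\mu_{j+2},\ldots)\le_{GDom}\partial^{(i_1,\ldots,i_j)}(\gamma/\lambda).$$ Moreover, for $\mu=\partial^{(0)}(\gamma/\lambda)$ one has $c^{\gamma}_{\lambda,\mu}=1$; that is, $\partial^{(0)}(\gamma/\lambda)$ is the maximum partition $\mu$ with $c^{\gamma}_{\lambda,\mu}\neq0$ with respect to the generalized dominance order.
   Context: For partitions $\lambda\subseteq\gamma$, where $\gamma=(\gamma_1,\ldots,\gamma_n)$ and $\lambda$ is padded by zeros to $(\lambda_1,\ldots,\lambda_n)$, the skew shape $\gamma/\lambda$ is the set of cells $(i,j)$ (row $i$ from the top, column $j$ from the left) with $\lambda_i<j\le\gamma_i$; it has $n$ rows. The top-left standardization ${}^\leftarrow\!\uparrow(\gamma/\lambda)$ is the transpose of the partition obtained by listing the column sizes of $\gamma/\lambda$ in non-increasing order; its $i$-th part is the number of columns with at least $i$ cells. For $1\le i_1<\cdots<i_j\le n$, $\gamma/\lambda^{(i_1,\ldots,i_j)}$ denotes the skew shape obtained by deleting rows $i_1,\ldots,i_j$ of $\gamma/\lambda$ and concatenating the remaining rows vertically (keeping their horizontal positions), i.e. $\tilde\gamma/\tilde\lambda$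 where $\tilde\gamma,\tilde\lambda$ are obtained from $(\gamma_1,\ldots,\gamma_n)$, $(\lambda_1,\ldots,\lambda_n)$ by deleting the entries in positions $i_1,\ldots,i_j$. Upper derivations: $\partial^{(0)}(\gamma/\lambda)={}^\leftarrow\!\uparrow(\gamma/\lambda)$ and $\partial^{(i_1,\ldots,i_j)}(\gamma/\lambda)={}^\leftarrow\!\uparrow(\gamma/\lambda^{(i_1,\ldots,i_j)})$. Generalized dominance order: for a partition $\alpha=(\alpha_1,\ldots,\alpha_k)$ of $n'$ and a partition $\beta=(\beta_1,\ldots,\beta_l)$ of $m'$ with $n'\le m'$, $\alpha\le_{GDom}\beta$ means $\alpha_1+\cdots+\alpha_i\le\beta_1+\cdots+\beta_i$ for all $1\le i\le\min\{k,l\}$. $c^{\gamma}_{\lambda,\mu}$ is the Littlewood–Richardson coefficient ($s_\lambda s_\mu=\sum_\gamma c^\gamma_{\lambda,\mu}s_\gamma$), equal to the number of Littlewood–Richardson tableaux of shape $\gamma/\lambda$ and content $\mu$, i.e. semi-standard tableaux of shape $\gamma/\lambda$ (rows weakly increasing left to right, columns strictly increasing downward) with $\mu_i$ labels equal to $i$, whose reverse row word (rows read right to left, top row first) is a lattice word (every prefix contains, for each $b\ge2$, at most as many $b$'s as $(b-1)$'s). -}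

module Defs where

open import Data.Nat using (ℕ; zero; suc; _+_; _∸_; _≤_; _<_; _⊔_; _⊓_; _≡ᵇ_; _<ᵇ_)
open import Data.Bool using (Bool; true; false; _∧_; _∨_; not; if_then_else_)
open import Data.List using (List; []; _∷_; length; take; drop; map; concat;
  concatMap; reverse; zip; replicate; applyUpTo; filterᵇ; foldr; inits)
open import Data.Nat.ListAction using (sum)
open import Data.Bool.ListAction using (all; any)
open import Data.List.Relation.Unary.All using (All)
open import Data.List.Relation.Unary.Linked using (Linked)
open import Data.Product using (_×_; _,_; proj₁; proj₂)

_≤ᵇ_ : ℕ → ℕ → Bool
m ≤ᵇ n = m <ᵇ suc n

countᵇ : {A : Set} → (A → Bool) → List A → ℕ
countᵇ p xs = length (filterᵇ p xs)

range : ℕ → ℕ → List ℕ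
range a b = applyUpTo (λ i → a + i) (suc b ∸ a)

maxList : List ℕ → ℕ
maxList = foldr _⊔_ 0

-- i-th entry (1-indexed) of a sequence, padded by zeros
part : List ℕ → ℕ → ℕ
part []       _             = 0
part (x ∷ xs) zero          = 0
part (x ∷ xs) (suc zero)    = x
part (x ∷ xs) (suc (suc i)) = part xs (suc i)

-- entry at 0-indexed position, 0 if out of range
at : List ℕ → ℕ → ℕ
at []       _       = 0
at (x ∷ xs) zero    = x
at (x ∷ xs) (suc i) = at xs i

IsPartition : List ℕ → Set
IsPartition xs = Linked (λ a b → b ≤ a) xs × All (λ a → 0 < a) xs

_⊆ₚ_ : List ℕ → List ℕ → Set
la ⊆ₚ ga = length la ≤ length ga × (∀ i → part la i ≤ part ga i)

pad : ℕ → List ℕ → List ℕ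
pad n la = la ++' replicate (n ∸ length la) 0
  where
  _++'_ : List ℕ → List ℕ → List ℕ
  []       ++' ys = ys
  (x ∷ xs) ++' ys = x ∷ (xs ++' ys)

-- Skew shapes given by row data g = (g_1..g_n), l = (l_1..l_n):
-- cells (i,j) with l_i < j ≤ g_i.

colSize : List ℕ → List ℕ → ℕ → ℕ
colSize g l c = countᵇ (λ p → (proj₂ p <ᵇ c) ∧ (c ≤ᵇ proj₁ p)) (zip g l)

std : List ℕ → List ℕ → List ℕ
std g l = filterᵇ (λ a → 0 <ᵇ a)
  (map (λ i → countᵇ (λ c → i ≤ᵇ colSize g l c) (range 1 (maxList g)))
       (range 1 (length g)))

delRows : List ℕ → List ℕ → List ℕ
delRows I xs = go 1 xs
  where
  go : ℕ → List ℕ → List ℕ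
  go p []       = []
  go p (x ∷ xs) = if any (λ i → i ≡ᵇ p) I then go (suc p) xs else x ∷ go (suc p) xs

∂⁰ : List ℕ → List ℕ → List ℕ
∂⁰ ga la = std ga (pad (length ga) la)

∂ : List ℕ → List ℕ → List ℕ → List ℕ
∂ I ga la = std (delRows I ga) (delRows I (pad (length ga) la))

IncSeq : ℕ → List ℕ → Set
IncSeq n I = Linked _<_ I × All (λ i → 1 ≤ i × i ≤ n) I

_≤GDom_ : List ℕ → List ℕ → Set
α ≤GDom β = sum α ≤ sum β ×
  (∀ i → 1 ≤ i → i ≤ length α ⊓ length β → sum (take i α) ≤ sum (take i β))

-- Littlewood–Richardson tableaux of shape γ/λ and content μ.
-- A filling is a list of rows (top to bottom); row r lists its entries
-- from left to right, occupying columns l_r+1 .. g_r.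

sortedᵇ : List ℕ → Bool
sortedᵇ []           = true
sortedᵇ (x ∷ [])     = true
sortedᵇ (x ∷ y ∷ xs) = (x ≤ᵇ y) ∧ sortedᵇ (y ∷ xs)

shapeOKᵇ : List ℕ → List ℕ → List (List ℕ) → Bool
shapeOKᵇ []       []       []       = true
shapeOKᵇ (g ∷ gs) (l ∷ ls) (w ∷ ws) = (length w ≡ᵇ (g ∸ l)) ∧ shapeOKᵇ gs ls ws
shapeOKᵇ _        _        _        = false

colStrictᵇ : ℕ → List ℕ → List ℕ → List (List ℕ) → Bool
colStrictᵇ K (g ∷ g' ∷ gs) (l ∷ l' ∷ ls) (w ∷ w' ∷ ws) =
  all (λ c → not ((l <ᵇ c) ∧ (c ≤ᵇ g) ∧ (l' <ᵇ c) ∧ (c ≤ᵇ g'))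
             ∨ (at w (c ∸ l ∸ 1) <ᵇ at w' (c ∸ l' ∸ 1)))
      (range 1 K)
  ∧ colStrictᵇ K (g' ∷ gs) (l' ∷ ls) (w' ∷ ws)
colStrictᵇ K _ _ _ = true

contentᵇ : List ℕ → List ℕ → Bool
contentᵇ mu word =
  all (λ a → (1 ≤ᵇ a) ∧ (a ≤ᵇ length mu)) word
  ∧ all (λ a → countᵇ (λ x → x ≡ᵇ a) word ≡ᵇ part mu a) (range 1 (length mu))

latticeᵇ : List ℕ → Bool
latticeᵇ word =
  all (λ pre → all (λ b → countᵇ (λ x → x ≡ᵇ b) pre ≤ᵇ countᵇ (λ x → x ≡ᵇ (b ∸ 1)) pre)
                   (range 2 (maxList word)))
      (inits word)

revRowWord : List (List ℕ) → List ℕ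
revRowWord ws = concatMap reverse ws

isLRᵇ : List ℕ → List ℕ → List ℕ → List (List ℕ) → Bool
isLRᵇ g l mu ws =
  shapeOKᵇ g l ws ∧ all sortedᵇ ws ∧ colStrictᵇ (maxList g) g l ws
  ∧ contentᵇ mu (concat ws) ∧ latticeᵇ (revRowWord ws)

words : ℕ → ℕ → List (List ℕ)
words zero    m = [] ∷ []
words (suc L) m = concatMap (λ a → map (a ∷_) (words L m)) (range 1 m)

-- all fillings of rows with given lengths by entries from 1..m
-- (a finite superset of the LR tableaux with content μ when m = ℓ(μ))
fillings : List ℕ → ℕ → List (List (List ℕ))
fillings []       m = [] ∷ []
fillings (L ∷ Ls) m = concatMap (λ w → map (w ∷_) (fillings Ls m)) (words L m)

rowLengths : List ℕ → List ℕ → List ℕ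
rowLengths g l = map (λ p → proj₁ p ∸ proj₂ p) (zip g l)

LRcoeff : List ℕ → List ℕ → List ℕ → ℕ
LRcoeff ga la mu =
  let g = ga ; l = pad (length ga) la in
  countᵇ (isLRᵇ g l mu) (fillings (rowLengths g l) (length mu))

{-# OPTIONS --safe #-}

-- Let T be a Littlewood–Richardson tableau of content μ. Since rows are read from right to left,
-- the lattice condition says that the entries b + 1 in rows ≤ r are at most as many as the
-- entries b in rows < r. Using this once at each deleted row bounds the number of entries
-- a + j of T by the number of entries a + s in the kept rows, where s ≤ j counts the deleted
-- rows above. In a single column and for a single a, at most one kept row has the entry a + s,
-- because the entries increase strictly also across the deleted rows. So for a ≤ i a column
-- contributes at most min(i, number of kept cells), and summing over the columns gives the i-th
-- partial sum of the standardization.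
--
-- Numbering every column 1, 2, 3, … from the top gives an LR tableau of content ∂⁰. Every LR
-- tableau of the shape dominates it cell by cell, and if the contents agree then so do the sums
-- of all entries, which forces equality.

module Submission where

open import Defs
open import Data.Bool using (Bool; true; false; T; _∧_; _∨_; not; if_then_else_)
open import Data.Bool.ListAction using (any; all)
open import Data.Bool.Properties using (T-∧; T?)
open import Data.List using (List; []; _∷_; _++_; length; map; concat; concatMap; take; drop;
  applyUpTo; filterᵇ; zip; replicate; reverse; inits; cartesianProductWith)
open import Data.List.Membership.Propositional using (_∈_)
open import Data.List.Membership.Propositional.Properties
  using (∈-map⁺; ∈-++⁺ˡ; ∈-applyUpTo⁺; ∈-applyUpTo⁻; ∈-cartesianProductWith⁺)
open import Data.List.Properties using (map-applyUpTo; map-∘; map-id; length-map; length-++;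
  length-applyUpTo; length-replicate; filter-++; take-all; ++-assoc; ++-identityʳ; reverse-++; ∷-injective)
open import Data.List.Relation.Binary.Permutation.Propositional.Properties using (↭-reverse)
  renaming (map⁺ to ↭-map⁺)
open import Data.List.Relation.Binary.Pointwise using (Pointwise; []; _∷_)
open import Data.List.Relation.Unary.All using (All; []; _∷_)
import Data.List.Relation.Unary.All as All
import Data.List.Relation.Unary.All.Properties as All
open import Data.List.Relation.Unary.AllPairs using ([]; _∷_)
open import Data.List.Relation.Unary.Any using (here; there)
open import Data.List.Relation.Unary.Linked using (Linked; []; [-]; _∷_)
import Data.List.Relation.Unary.Linked as Linked
import Data.List.Relation.Unary.Linked.Properties as Linked
open import Data.List.Relation.Unary.Unique.Propositional using (Unique)
import Data.List.Relation.Unary.Unique.Propositional.Properties as Unique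
open import Data.Nat using (ℕ; zero; suc; _+_; _*_; _∸_; _≤_; _<_; _≥_; _⊓_; _≡ᵇ_; _<ᵇ_;
  z≤n; s≤s; s≤s⁻¹)
open import Data.Nat.ListAction using (sum)
open import Data.Nat.ListAction.Properties using (sum-++; sum-↭)
open import Data.Nat.Properties
open import Algebra.Properties.CommutativeSemigroup +-commutativeSemigroup using (interchange; x∙yz≈y∙xz)
open import Data.Product using (_×_; _,_; proj₁; proj₂; ∃; ∃₂)
open import Data.Sum using (_⊎_; inj₁; inj₂)
open import Data.Unit using (⊤; tt)
open import Function using (_∘_; id; Equivalence)
open import Relation.Binary.PropositionalEquality
  using (_≡_; _≢_; refl; sym; trans; cong; cong₂; subst; subst₂; module ≡-Reasoning)
open import Relation.Nullary using (¬_; yes; no; contradiction)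

private variable
  A B : Set

-- Boolean reflection, indicators and finite sums

∧⁻ : ∀ x {y} → T (x ∧ y) → T x × T y
∧⁻ x = Equivalence.to (T-∧ {x})

∧⁺ : ∀ x {y} → T x → T y → T (x ∧ y)
∧⁺ x p q = Equivalence.from (T-∧ {x}) (p , q)

≤ᵇ⁻ : ∀ m n → T (m ≤ᵇ n) → m ≤ n
≤ᵇ⁻ m n = s≤s⁻¹ ∘ <ᵇ⇒< m (suc n)

≤ᵇ⁺ : ∀ {m n} → m ≤ n → T (m ≤ᵇ n)
≤ᵇ⁺ = <⇒<ᵇ ∘ s≤s

𝟙 : Bool → ℕ
𝟙 b = if b then 1 else 0

𝟙≤1 : ∀ b → 𝟙 b ≤ 1
𝟙≤1 true  = ≤-refl
𝟙≤1 false = z≤n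

𝟙-true : ∀ {b} → T b → 𝟙 b ≡ 1
𝟙-true {true} _ = refl

𝟙-false : ∀ {b} → ¬ T b → 𝟙 b ≡ 0
𝟙-false {true}  ¬b = contradiction _ ¬b
𝟙-false {false} _  = refl

𝟙-mono : ∀ {b c} → (T b → T c) → 𝟙 b ≤ 𝟙 c
𝟙-mono {true}  f = ≤-reflexive (sym (𝟙-true (f _)))
𝟙-mono {false} f = z≤n

∑ : List A → (A → ℕ) → ℕ
∑ xs f = sum (map f xs)

∑-cong : ∀ xs {f g : A → ℕ} → (∀ {x} → x ∈ xs → f x ≡ g x) → ∑ xs f ≡ ∑ xs g
∑-cong []       eq = refl
∑-cong (x ∷ xs) eq = cong₂ _+_ (eq (here refl)) (∑-cong xs (eq ∘ there))

∑-mono : ∀ xs {f g : A → ℕ} → (∀ {x} → x ∈ xs → f x ≤ g x) → ∑ xs f ≤ ∑ xs g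
∑-mono []       le = z≤n
∑-mono (x ∷ xs) le = +-mono-≤ (le (here refl)) (∑-mono xs (le ∘ there))

∑-zero : ∀ xs {f : A → ℕ} → (∀ {x} → x ∈ xs → f x ≡ 0) → ∑ xs f ≡ 0
∑-zero []       eq = refl
∑-zero (x ∷ xs) eq = cong₂ _+_ (eq (here refl)) (∑-zero xs (eq ∘ there))

∑-≤length : ∀ xs {f : A → ℕ} → (∀ x → f x ≤ 1) → ∑ xs f ≤ length xs
∑-≤length []       le = z≤n
∑-≤length (x ∷ xs) le = +-mono-≤ (le x) (∑-≤length xs le)

∑-+ : ∀ xs (f g : A → ℕ) → ∑ xs (λ x → f x + g x) ≡ ∑ xs f + ∑ xs g
∑-+ []       f g = refl
∑-+ (x ∷ xs) f g = begin
  f x + g x + ∑ xs (λ x → f x + g x)  ≡⟨ cong (f x + g x +_) (∑-+ xs f g) ⟩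
  f x + g x + (∑ xs f + ∑ xs g)       ≡⟨ interchange (f x) (g x) _ _ ⟩
  f x + ∑ xs f + (g x + ∑ xs g)       ∎
  where open ≡-Reasoning

∑-swap : ∀ (xs : List A) (ys : List B) (f : A → B → ℕ) →
         ∑ xs (λ x → ∑ ys (f x)) ≡ ∑ ys (λ y → ∑ xs (λ x → f x y))
∑-swap []       ys f = sym (∑-zero ys λ _ → refl)
∑-swap (x ∷ xs) ys f =
  trans (cong (∑ ys (f x) +_) (∑-swap xs ys f)) (sym (∑-+ ys (f x) _))

∑-map : ∀ (h : A → B) xs {f : B → ℕ} → ∑ (map h xs) f ≡ ∑ xs (f ∘ h)
∑-map h xs = cong sum (sym (map-∘ xs))

∑-*ˡ : ∀ k xs {f : A → ℕ} → ∑ xs (λ x → k * f x) ≡ k * ∑ xs f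
∑-*ˡ k []           = sym (*-zeroʳ k)
∑-*ˡ k (x ∷ xs) {f} = trans (cong (k * f x +_) (∑-*ˡ k xs)) (sym (*-distribˡ-+ k (f x) _))

countᵇ-∑ : ∀ (p : A → Bool) xs → countᵇ p xs ≡ ∑ xs (𝟙 ∘ p)
countᵇ-∑ p []       = refl
countᵇ-∑ p (x ∷ xs) with p x
... | true  = cong suc (countᵇ-∑ p xs)
... | false = countᵇ-∑ p xs

countᵇ-++ : ∀ (p : A → Bool) xs ys → countᵇ p (xs ++ ys) ≡ countᵇ p xs + countᵇ p ys
countᵇ-++ p xs ys = trans (cong length (filter-++ (T? ∘ p) xs ys)) (length-++ (filterᵇ p xs))

countᵇ-concat : ∀ (p : A → Bool) xss → countᵇ p (concat xss) ≡ ∑ xss (countᵇ p)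
countᵇ-concat p []         = refl
countᵇ-concat p (xs ∷ xss) =
  trans (countᵇ-++ p xs (concat xss)) (cong (countᵇ p xs +_) (countᵇ-concat p xss))

countᵇ-none : ∀ {p : A → Bool} {xs} → All (¬_ ∘ T ∘ p) xs → countᵇ p xs ≡ 0
countᵇ-none {p = p} {xs} ¬p =
  trans (countᵇ-∑ p xs) (∑-zero xs λ x∈xs → 𝟙-false (All.lookup ¬p x∈xs))

countᵇ-some : ∀ {p : A → Bool} {xs x} → x ∈ xs → T (p x) → 1 ≤ countᵇ p xs
countᵇ-some {p = p} {_ ∷ xs} {x} (here refl) px with p x
... | true = s≤s z≤n
countᵇ-some {p = p} {y ∷ xs} (there x∈xs) px with p y
... | true  = s≤s z≤n
... | false = countᵇ-some x∈xs px

countᵇ-witness : ∀ (p : A → Bool) xs → countᵇ p xs ≢ 0 → ∃ λ x → T (p x)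
countᵇ-witness p []       ≢0 = contradiction refl ≢0
countᵇ-witness p (x ∷ xs) ≢0 with p x in eq
... | true  = x , subst T (sym eq) _
... | false = countᵇ-witness p xs ≢0

countᵇ≤1 : ∀ {p : A → Bool} {xs} → Unique xs →
           (∀ {x y} → T (p x) → T (p y) → x ≡ y) → countᵇ p xs ≤ 1
countᵇ≤1 []                                unique = z≤n
countᵇ≤1 {p = p} {x ∷ xs} (x∉xs ∷ distinct) unique with p x in eq
... | false = countᵇ≤1 distinct unique
... | true  = s≤s (≤-reflexive (countᵇ-none
  (All.map (λ x≢y py → x≢y (unique (subst T (sym eq) _) py)) x∉xs)))

-- Sums over initial segments of the positive integers

∈-range⁻ : ∀ {n x} → x ∈ range 1 n → 1 ≤ x × x ≤ n
∈-range⁻ x∈ with _ , k<n , refl ← ∈-applyUpTo⁻ suc x∈ = s≤s z≤n , k<n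

∈-range⁺ : ∀ {n x} → 1 ≤ x → x ≤ n → x ∈ range 1 n
∈-range⁺ {x = suc _} _ x≤n = ∈-applyUpTo⁺ suc x≤n

range-unique : ∀ n → Unique (range 1 n)
range-unique n = Unique.applyUpTo⁺₁ suc n λ i<j _ eq → <⇒≢ i<j (suc-injective eq)

∑-range-suc : ∀ n f → ∑ (range 1 (suc n)) f ≡ f 1 + ∑ (range 1 n) (f ∘ suc)
∑-range-suc n f = cong (λ xs → f 1 + sum xs)
  (trans (map-applyUpTo (suc ∘ suc) f n) (sym (map-applyUpTo suc (f ∘ suc) n)))

-- With `n` a column height, this turns the bound on one column into its contribution to the `i`-th
-- partial sum of the standardization.
∑-≤ᵇ : ∀ i n → ∑ (range 1 i) (λ a → 𝟙 (a ≤ᵇ n)) ≡ i ⊓ n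
∑-≤ᵇ zero    n       = refl
∑-≤ᵇ (suc i) zero    = ∑-zero (range 1 (suc i)) λ {x} x∈ →
  𝟙-false λ x≤0 → <⇒≱ (proj₁ (∈-range⁻ x∈)) (≤ᵇ⁻ x 0 x≤0)
∑-≤ᵇ (suc i) (suc n) =
  trans (∑-range-suc i (λ a → 𝟙 (a ≤ᵇ suc n))) (cong suc (∑-≤ᵇ i n))

∑-δ : ∀ f m v → 1 ≤ v → v ≤ m → ∑ (range 1 m) (λ a → f a * 𝟙 (v ≡ᵇ a)) ≡ f v
∑-δ f (suc m) (suc zero) _ _ = begin
  ∑ (range 1 (suc m)) (λ a → f a * 𝟙 (1 ≡ᵇ a))
    ≡⟨ ∑-range-suc m (λ a → f a * 𝟙 (1 ≡ᵇ a)) ⟩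
  f 1 * 1 + ∑ (range 1 m) (λ a → f (suc a) * 𝟙 (0 ≡ᵇ a))
    ≡⟨ cong₂ _+_ (*-identityʳ (f 1)) (∑-zero (range 1 m) (λ {a} → off a)) ⟩
  f 1 + 0
    ≡⟨ +-identityʳ (f 1) ⟩
  f 1 ∎
  where
  open ≡-Reasoning
  off : ∀ a → a ∈ range 1 m → f (suc a) * 𝟙 (0 ≡ᵇ a) ≡ 0
  off zero    a∈ = contradiction (proj₁ (∈-range⁻ a∈)) λ ()
  off (suc a) a∈ = *-zeroʳ (f (suc (suc a)))
∑-δ f (suc m) (suc (suc v)) _ (s≤s v<m) = begin
  ∑ (range 1 (suc m)) (λ a → f a * 𝟙 (suc (suc v) ≡ᵇ a))
    ≡⟨ ∑-range-suc m (λ a → f a * 𝟙 (suc (suc v) ≡ᵇ a)) ⟩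
  f 1 * 0 + ∑ (range 1 m) (λ a → f (suc a) * 𝟙 (suc v ≡ᵇ a))
    ≡⟨ cong₂ _+_ (*-zeroʳ (f 1)) (∑-δ (f ∘ suc) m (suc v) (s≤s z≤n) v<m) ⟩
  f (suc (suc v)) ∎
  where open ≡-Reasoning

-- Parts, partial sums and generalized dominance

part-[] : ∀ {xs} a → length xs < a → part xs a ≡ 0
part-[] {[]}     a             _         = refl
part-[] {x ∷ xs} (suc (suc a)) (s≤s l<a) = part-[] {xs} (suc a) l<a

part-drop : ∀ j xs a → part (drop j xs) (suc a) ≡ part xs (suc (a + j))
part-drop zero    xs       a = cong (part xs ∘ suc) (sym (+-identityʳ a))
part-drop (suc j) []       a = refl
part-drop (suc j) (x ∷ xs) a =
  trans (part-drop j xs a) (cong (part (x ∷ xs) ∘ suc) (sym (+-suc a j)))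

sum-take : ∀ i xs → sum (take i xs) ≡ ∑ (range 1 i) (part xs)
sum-take zero    xs       = refl
sum-take (suc i) []       = sym (∑-zero (range 1 (suc i)) λ _ → refl)
sum-take (suc i) (x ∷ xs) = begin
  x + sum (take i xs)                     ≡⟨ cong (x +_) (sum-take i xs) ⟩
  x + ∑ (range 1 i) (part xs)             ≡⟨ cong (x +_) (∑-cong (range 1 i) (λ {a} → shift a)) ⟩
  x + ∑ (range 1 i) (part (x ∷ xs) ∘ suc) ≡⟨ ∑-range-suc i (part (x ∷ xs)) ⟨
  ∑ (range 1 (suc i)) (part (x ∷ xs))     ∎
  where
  open ≡-Reasoning
  shift : ∀ a → a ∈ range 1 i → part xs a ≡ part (x ∷ xs) (suc a)
  shift zero    a∈ = contradiction (proj₁ (∈-range⁻ a∈)) λ ()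
  shift (suc a) _  = refl

sum-take≤sum : ∀ i xs → sum (take i xs) ≤ sum xs
sum-take≤sum zero    xs       = z≤n
sum-take≤sum (suc i) []       = z≤n
sum-take≤sum (suc i) (x ∷ xs) = +-monoʳ-≤ x (sum-take≤sum i xs)

-- Parts padded by zeros allow every `i`; taking `i` to be the length of `α` yields the comparison
-- of the sizes.
≤GDom⁺ : ∀ {α β} → (∀ i → ∑ (range 1 i) (part α) ≤ ∑ (range 1 i) (part β)) → α ≤GDom β
≤GDom⁺ {α} {β} le = total , λ i _ _ → partial i
  where
  open ≤-Reasoning
  partial : ∀ i → sum (take i α) ≤ sum (take i β)
  partial i = begin
    sum (take i α)         ≡⟨ sum-take i α ⟩
    ∑ (range 1 i) (part α) ≤⟨ le i ⟩
    ∑ (range 1 i) (part β) ≡⟨ sum-take i β ⟨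
    sum (take i β)         ∎
  total : sum α ≤ sum β
  total = begin
    sum α                     ≡⟨ cong sum (take-all (length α) α ≤-refl) ⟨
    sum (take (length α) α)   ≤⟨ partial (length α) ⟩
    sum (take (length α) β)   ≤⟨ sum-take≤sum (length α) β ⟩
    sum β                     ∎

-- A weakly decreasing sequence has all its zeros at the end, so the filter only cuts off a tail.
-- Once `f 0` is zero, every later value is zero as well.
part-filter : ∀ f n → (∀ a → f (suc a) ≤ f a) → (∀ a → n ≤ a → f a ≡ 0) →
              ∀ a → part (filterᵇ (0 <ᵇ_) (applyUpTo f n)) (suc a) ≡ f a
part-filter f zero    anti vanish a = sym (vanish a z≤n)
part-filter f (suc n) anti vanish a with f 0 in f0
part-filter f (suc n) anti vanish zero | suc _ = sym f0
part-filter f (suc n) anti vanish (suc a) | suc _ =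
  part-filter (f ∘ suc) n (anti ∘ suc) (λ a → vanish (suc a) ∘ s≤s) a
part-filter f (suc n) anti vanish a | zero = begin
  part (filterᵇ (0 <ᵇ_) (applyUpTo (f ∘ suc) n)) (suc a)
    ≡⟨ part-filter (f ∘ suc) n (anti ∘ suc) (λ a → vanish (suc a) ∘ s≤s) a ⟩
  f (suc a) ≡⟨ allZero (suc a) ⟩
  0         ≡⟨ allZero a ⟨
  f a       ∎
  where
  open ≡-Reasoning
  allZero : ∀ a → f a ≡ 0
  allZero zero    = f0
  allZero (suc a) = n≤0⇒n≡0 (≤-trans (anti a) (≤-reflexive (allZero a)))

-- Skew shapes and their column heights

-- A row is the pair of its outer and inner bound, so the two lists of bounds cannot differ in
-- length.
Shape : Set
Shape = List (ℕ × ℕ)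

outer inner : Shape → List ℕ
outer = map proj₁
inner = map proj₂

inCol : ℕ × ℕ → ℕ → Bool
inCol p c = (proj₂ p <ᵇ c) ∧ (c ≤ᵇ proj₁ p)

inCol⁻ : ∀ p {c} → T (inCol p c) → proj₂ p < c × c ≤ proj₁ p
inCol⁻ p {c} t with l<c , c≤g ← ∧⁻ (proj₂ p <ᵇ c) t =
  <ᵇ⇒< _ _ l<c , ≤ᵇ⁻ c _ c≤g

inCol⁺ : ∀ p {c} → proj₂ p < c → c ≤ proj₁ p → T (inCol p c)
inCol⁺ p {c} l<c c≤g = ∧⁺ (proj₂ p <ᵇ c) (<⇒<ᵇ l<c) (≤ᵇ⁺ c≤g)

height : Shape → ℕ → ℕ
height sh c = ∑ sh (λ p → 𝟙 (inCol p c))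

columns : Shape → List ℕ
columns sh = range 1 (maxList (outer sh))

-- The parts of the top-left standardization as a function, with the trailing zeros kept.
conj : Shape → ℕ → ℕ
conj sh a = ∑ (columns sh) (λ c → 𝟙 (a ≤ᵇ height sh c))

zip-unzip : ∀ (sh : Shape) → zip (outer sh) (inner sh) ≡ sh
zip-unzip []       = refl
zip-unzip (p ∷ sh) = cong (p ∷_) (zip-unzip sh)

colSize-height : ∀ sh c → colSize (outer sh) (inner sh) c ≡ height sh c
colSize-height sh c =
  trans (cong (countᵇ _) (zip-unzip sh)) (countᵇ-∑ (λ p → inCol p c) sh)

conj-antitone : ∀ sh a → conj sh (suc a) ≤ conj sh a
conj-antitone sh a = ∑-mono (columns sh) λ {c} _ →
  𝟙-mono λ a<h → ≤ᵇ⁺ (<⇒≤ (≤ᵇ⁻ (suc a) (height sh c) a<h))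

conj-vanishes : ∀ sh a → length sh < a → conj sh a ≡ 0
conj-vanishes sh a n<a = ∑-zero (columns sh) λ {c} _ →
  𝟙-false λ a≤h → <⇒≱ n<a
    (≤-trans (≤ᵇ⁻ a (height sh c) a≤h) (∑-≤length sh λ p → 𝟙≤1 (inCol p c)))

std-conj : ∀ sh →
  std (outer sh) (inner sh) ≡ filterᵇ (0 <ᵇ_) (applyUpTo (conj sh ∘ suc) (length (outer sh)))
std-conj sh = cong (filterᵇ (0 <ᵇ_)) (trans (map-applyUpTo suc _ (length (outer sh)))
  (applyUpTo-cong λ i → trans (countᵇ-∑ _ (columns sh))
    (∑-cong (columns sh) λ {c} _ → cong (λ h → 𝟙 (suc i ≤ᵇ h)) (colSize-height sh c))))
  where
  applyUpTo-cong : ∀ {f g : ℕ → ℕ} {n} → (∀ i → f i ≡ g i) → applyUpTo f n ≡ applyUpTo g n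
  applyUpTo-cong {n = zero}  eq = refl
  applyUpTo-cong {n = suc n} eq = cong₂ _∷_ (eq 0) (applyUpTo-cong (eq ∘ suc))

part-std : ∀ sh a → part (std (outer sh) (inner sh)) (suc a) ≡ conj sh (suc a)
part-std sh a = trans (cong (λ xs → part xs (suc a)) (std-conj sh))
  (part-filter (conj sh ∘ suc) (length (outer sh)) (conj-antitone sh ∘ suc)
    (λ b n≤b → conj-vanishes sh (suc b) (s≤s (subst (_≤ b) (length-map proj₁ sh) n≤b))) a)

-- Tableaux

Row : Set
Row = (ℕ × ℕ) × List ℕ

shape : List Row → Shape
shape = map proj₁

-- Columns are numbered from 1; outside the columns of the row the value is junk.
entry : Row → ℕ → ℕ
entry ((g , l) , w) c = at w (c ∸ l ∸ 1)

Fits : Row → Set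
Fits ((g , l) , w) = length w ≡ g ∸ l

-- Decreasing bounds make each column a contiguous run of rows, so the strict increase between
-- neighbouring rows propagates through the whole column.
_above_ : Row → Row → Set
r above r' =
  proj₁ (proj₁ r') ≤ proj₁ (proj₁ r) ×
  proj₂ (proj₁ r') ≤ proj₂ (proj₁ r) ×
  (∀ c → T (inCol (proj₁ r) c) → T (inCol (proj₁ r') c) → entry r c < entry r' c)

occ : ℕ → Row → ℕ
occ b r = countᵇ (_≡ᵇ b) (proj₂ r)

-- Lets counts by rows be exchanged for counts by columns. The induction strips the first column: it
-- carries the first entry when the inner bound is 0, and otherwise both bounds drop by one.
countᵇ-row : ∀ (p : ℕ → Bool) K r → Fits r → proj₁ (proj₁ r) ≤ K →
  countᵇ p (proj₂ r) ≡ ∑ (range 1 K) (λ c → 𝟙 (inCol (proj₁ r) c ∧ p (entry r c)))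
countᵇ-row p K ((zero , l) , []) _ _ = sym (∑-zero (range 1 K) λ {c} c∈ →
  𝟙-false λ t → <⇒≱ (proj₁ (∈-range⁻ c∈)) (proj₂ (inCol⁻ (0 , l) (proj₁ (∧⁻ (inCol (0 , l) c) t)))))
countᵇ-row p K ((zero , l) , x ∷ w) fits _ = contradiction (trans fits (0∸n≡0 l)) λ ()
countᵇ-row p (suc K) ((suc g , zero) , x ∷ w) fits (s≤s g≤K) = begin
  countᵇ p (x ∷ w)
    ≡⟨ countᵇ-∑ p (x ∷ w) ⟩
  𝟙 (p x) + ∑ w (𝟙 ∘ p)
    ≡⟨ cong (𝟙 (p x) +_) (sym (countᵇ-∑ p w)) ⟩
  𝟙 (p x) + countᵇ p w
    ≡⟨ cong (𝟙 (p x) +_) (countᵇ-row p K ((g , zero) , w) (suc-injective fits) g≤K) ⟩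
  𝟙 (p x) + ∑ (range 1 K) (λ c → 𝟙 (inCol (g , zero) c ∧ p (at w (c ∸ 1))))
    ≡⟨ cong (𝟙 (p x) +_) (∑-cong (range 1 K) (λ {c} → shift c)) ⟩
  𝟙 (p x) + ∑ (range 1 K) (λ c → 𝟙 (inCol (suc g , zero) (suc c) ∧ p (at (x ∷ w) c)))
    ≡⟨ ∑-range-suc K (λ c → 𝟙 (inCol (suc g , zero) c ∧ p (at (x ∷ w) (c ∸ 1)))) ⟨
  ∑ (range 1 (suc K)) (λ c → 𝟙 (inCol (suc g , zero) c ∧ p (at (x ∷ w) (c ∸ 1)))) ∎
  where
  open ≡-Reasoning
  shift : ∀ c → c ∈ range 1 K →
    𝟙 (inCol (g , zero) c ∧ p (at w (c ∸ 1))) ≡ 𝟙 (inCol (suc g , zero) (suc c) ∧ p (at (x ∷ w) c))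
  shift zero    c∈ = contradiction (proj₁ (∈-range⁻ c∈)) λ ()
  shift (suc c) _  = refl
countᵇ-row p (suc K) ((suc g , suc l) , w) fits (s≤s g≤K) =
  trans (countᵇ-row p K ((g , l) , w) fits g≤K)
    (sym (∑-range-suc K (λ c → 𝟙 (inCol (suc g , suc l) c ∧ p (at w (c ∸ suc l ∸ 1))))))

-- cnt b stands for the number of entries b in the rows already passed.
Lattice : (ℕ → ℕ) → List Row → Set
Lattice cnt []       = ⊤
Lattice cnt (r ∷ rs) =
  (∀ b → 1 ≤ b → cnt (suc b) + occ (suc b) r ≤ cnt b) × Lattice (λ b → cnt b + occ b r) rs

-- Deleting rows

-- Row p is deleted when δ p holds; shifted tags each kept row with the number of
-- deleted rows above it.
keep : (ℕ → Bool) → ℕ → List A → List A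
keep δ p []       = []
keep δ p (x ∷ xs) = if δ p then keep δ (suc p) xs else x ∷ keep δ (suc p) xs

shifted : (ℕ → Bool) → ℕ → ℕ → List A → List (ℕ × A)
shifted δ p s []       = []
shifted δ p s (x ∷ xs) =
  if δ p then shifted δ (suc p) (suc s) xs else (s , x) ∷ shifted δ (suc p) s xs

finalShift : (ℕ → Bool) → ℕ → ℕ → List A → ℕ
finalShift δ p s []       = s
finalShift δ p s (x ∷ xs) =
  if δ p then finalShift δ (suc p) (suc s) xs else finalShift δ (suc p) s xs

keep-map : ∀ δ p (f : A → B) xs → keep δ p (map f xs) ≡ map f (keep δ p xs)
keep-map δ p f []       = refl
keep-map δ p f (x ∷ xs) with δ p
... | true  = keep-map δ (suc p) f xs
... | false = cong (f x ∷_) (keep-map δ (suc p) f xs)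

shifted-keep : ∀ δ p s (xs : List A) → map proj₂ (shifted δ p s xs) ≡ keep δ p xs
shifted-keep δ p s []       = refl
shifted-keep δ p s (x ∷ xs) with δ p
... | true  = shifted-keep δ (suc p) (suc s) xs
... | false = cong (x ∷_) (shifted-keep δ (suc p) s xs)

All-shifted : ∀ {P : A → Set} δ p s {xs} → All P xs → All (P ∘ proj₂) (shifted δ p s xs)
All-shifted δ p s []         = []
All-shifted δ p s (px ∷ pxs) with δ p
... | true  = All-shifted δ (suc p) (suc s) pxs
... | false = px ∷ All-shifted δ (suc p) s pxs

hit : List ℕ → ℕ → Bool
hit I p = any (λ i → i ≡ᵇ p) I

-- Each deletion at `p` is paid for by an index in `I` equal to `p`, which is counted among the
-- indices from `p` on but not among those from `suc p` on.
finalShift≤ : ∀ I p s (xs : List A) →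
  finalShift (hit I) p s xs ≤ s + ∑ I (λ i → 𝟙 (p ≤ᵇ i))
finalShift≤ I p s []       = m≤m+n s _
finalShift≤ I p s (x ∷ xs) with hit I p | step I
  where
  step : ∀ I → 𝟙 (hit I p) + ∑ I (λ i → 𝟙 (suc p ≤ᵇ i)) ≤ ∑ I (λ i → 𝟙 (p ≤ᵇ i))
  step []      = z≤n
  step (i ∷ I) with i ≡ᵇ p in eq
  ... | true rewrite ≡ᵇ⇒≡ i p (subst T (sym eq) tt)
                   | 𝟙-true {p ≤ᵇ p} (≤ᵇ⁺ (≤-refl {p}))
                   | 𝟙-false {suc p ≤ᵇ p} (λ t → <-irrefl refl (≤ᵇ⁻ (suc p) p t)) =
    s≤s (∑-mono I λ {i} _ → 𝟙-mono λ t → ≤ᵇ⁺ (<⇒≤ (≤ᵇ⁻ (suc p) i t)))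
  ... | false = begin
    𝟙 (hit I p) + (𝟙 (suc p ≤ᵇ i) + ∑ I (λ i → 𝟙 (suc p ≤ᵇ i)))
      ≡⟨ x∙yz≈y∙xz (𝟙 (hit I p)) (𝟙 (suc p ≤ᵇ i)) _ ⟩
    𝟙 (suc p ≤ᵇ i) + (𝟙 (hit I p) + ∑ I (λ i → 𝟙 (suc p ≤ᵇ i)))
      ≤⟨ +-mono-≤ (𝟙-mono λ t → ≤ᵇ⁺ (<⇒≤ (≤ᵇ⁻ (suc p) i t))) (step I) ⟩
    𝟙 (p ≤ᵇ i) + ∑ I (λ i → 𝟙 (p ≤ᵇ i)) ∎
    where open ≤-Reasoning
... | true  | le = ≤-trans (finalShift≤ I (suc p) (suc s) xs)
  (≤-trans (≤-reflexive (sym (+-suc s _))) (+-monoʳ-≤ s le))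
... | false | le = ≤-trans (finalShift≤ I (suc p) s xs) (+-monoʳ-≤ s le)

-- The column argument

-- At a deleted row the lattice condition trades entries b + 1 for entries b higher up,
-- which compensates the increase of the shift.
cover : ∀ δ p s (cnt cnt′ : ℕ → ℕ) rs → Lattice cnt rs →
  (∀ b → 1 ≤ b → cnt (b + s) ≤ cnt′ b) → ∀ b → 1 ≤ b →
  cnt (b + finalShift δ p s rs) + ∑ rs (occ (b + finalShift δ p s rs))
    ≤ cnt′ b + ∑ (shifted δ p s rs) (λ q → occ (b + proj₁ q) (proj₂ q))
cover δ p s cnt cnt′ []       lat inv b 1≤b = +-monoˡ-≤ 0 (inv b 1≤b)
cover δ p s cnt cnt′ (r ∷ rs) (lat₁ , lat) inv b 1≤b with δ p
... | true  = ≤-trans (≤-reflexive (sym (+-assoc (cnt _) _ _)))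
  (cover δ (suc p) (suc s) _ cnt′ rs lat inv′ b 1≤b)
  where
  inv′ : ∀ b → 1 ≤ b → cnt (b + suc s) + occ (b + suc s) r ≤ cnt′ b
  inv′ b 1≤b rewrite +-suc b s =
    ≤-trans (lat₁ (b + s) (≤-trans 1≤b (m≤m+n b s))) (inv b 1≤b)
... | false = ≤-trans (≤-reflexive (sym (+-assoc (cnt _) _ _)))
  (≤-trans (cover δ (suc p) s _ (λ b → cnt′ b + occ (b + s) r) rs lat (λ b 1≤b → +-monoˡ-≤ (occ (b + s) r) (inv b 1≤b)) b 1≤b)
    (≤-reflexive (+-assoc (cnt′ b) _ _)))

selected : ℕ → ℕ → ℕ × Row → Bool
selected a c (s , r) = inCol (proj₁ r) c ∧ (entry r c ≡ᵇ a + s)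

selected-entry : ∀ {a c} s r → T (selected a c (s , r)) → entry r c ≡ a + s
selected-entry {a} {c} s r t = ≡ᵇ⇒≡ (entry r c) (a + s) (proj₂ (∧⁻ (inCol (proj₁ r) c) t))

hits : (ℕ → Bool) → ℕ → ℕ → ℕ → ℕ → List Row → ℕ
hits δ p s a c rs = ∑ (shifted δ p s rs) (𝟙 ∘ selected a c)

-- Outer bounds decrease downwards, so a column that has ended does not reappear.
hits-beyond : ∀ δ p s a c {r} rs → Linked _above_ (r ∷ rs) → proj₁ (proj₁ r) < c →
  hits δ p s a c rs ≡ 0
hits-beyond δ p s a c []        _                    _   = refl
hits-beyond δ p s a c (r′ ∷ rs) ((g′≤g , _) ∷ chain) g<c with δ p
... | true  = hits-beyond δ (suc p) (suc s) a c rs chain (≤-<-trans g′≤g g<c)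
... | false = cong₂ _+_
  (𝟙-false λ t → <⇒≱ (≤-<-trans g′≤g g<c) (proj₂ (inCol⁻ (proj₁ r′) (proj₁ (∧⁻ (inCol (proj₁ r′) c) t)))))
  (hits-beyond δ (suc p) s a c rs chain (≤-<-trans g′≤g g<c))

-- Down a column the entries grow by at least one at every row, while the target `a + s` grows by
-- one at deleted rows only. Once an entry has reached the target, the entry of every later kept row
-- lies strictly past it.
hits-below : ∀ δ p s a c {r} rs → Linked _above_ (r ∷ rs) → T (inCol (proj₁ r) c) →
  a + s ≤ entry r c → hits δ p s a c rs ≡ 0
hits-below δ p s a c []        _ _ _ = refl
hits-below δ p s a c {r} (r′ ∷ rs) ((g′≤g , l′≤l , strict) ∷ chain) r∋c a+s≤ with T? (inCol (proj₁ r′) c)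
-- The inner bound of `r′` is at most that of `r`, hence below `c`; so `c` can only be missing
-- because it exceeds the outer bound.
... | no r′∌c = hits-end
  where
  g′<c : proj₁ (proj₁ r′) < c
  g′<c = ≰⇒> λ c≤g′ → r′∌c (inCol⁺ (proj₁ r′) (≤-<-trans l′≤l (proj₁ (inCol⁻ (proj₁ r) r∋c))) c≤g′)
  hits-end : hits δ p s a c (r′ ∷ rs) ≡ 0
  hits-end with δ p
  ... | true  = hits-beyond δ (suc p) (suc s) a c rs chain g′<c
  ... | false = cong₂ _+_ (𝟙-false (r′∌c ∘ proj₁ ∘ ∧⁻ (inCol (proj₁ r′) c)))
    (hits-beyond δ (suc p) s a c rs chain g′<c)
... | yes r′∋c with strict c r∋c r′∋c | δ p
...   | e<e′ | true  = hits-below δ (suc p) (suc s) a c rs chain r′∋c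
  (≤-trans (≤-reflexive (+-suc a s)) (≤-<-trans a+s≤ e<e′))
...   | e<e′ | false = cong₂ _+_
  (𝟙-false λ t → <⇒≢ (≤-<-trans a+s≤ e<e′) (sym (selected-entry {a} {c} s r′ t)))
  (hits-below δ (suc p) s a c rs chain r′∋c (<⇒≤ (≤-<-trans a+s≤ e<e′)))

-- At the first hit the entry equals the target, so `hits-below` rules out any further one.
hits≤1 : ∀ δ p s a c {rs} → Linked _above_ rs → hits δ p s a c rs ≤ 1
hits≤1 δ p s a c {[]}     _     = z≤n
hits≤1 δ p s a c {r ∷ rs} chain with δ p
... | true  = hits≤1 δ (suc p) (suc s) a c (Linked.tail chain)
... | false with selected a c (s , r) in eq
...   | false = hits≤1 δ (suc p) s a c (Linked.tail chain)
...   | true  = s≤s (≤-reflexive (hits-below δ (suc p) s a c rs chain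
  (proj₁ (∧⁻ (inCol (proj₁ r) c) sel)) (≤-reflexive (sym (selected-entry {a} {c} s r sel)))))
  where sel = subst T (sym eq) tt

maxList-upper : ∀ (sh : Shape) → All (λ p → proj₁ p ≤ maxList (outer sh)) sh
maxList-upper []       = []
maxList-upper (p ∷ sh) = m≤m⊔n (proj₁ p) _ ∷
  All.map (λ le → ≤-trans le (m≤n⊔m (proj₁ p) _)) (maxList-upper sh)

-- Pairs of a label and a kept cell are counted in two ways: a label is hit at most once in the
-- column, and a cell is hit by at most one label because `a` is determined by its entry and its
-- shift.
column-hits : ∀ δ p c i {rs} → Linked _above_ rs →
  ∑ (range 1 i) (λ a → hits δ p 0 a c rs) ≤ i ⊓ height (keep δ p (shape rs)) c
column-hits δ p c i {rs} chain = ⊓-glb byLabel byRow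
  where
  open ≤-Reasoning
  byLabel : ∑ (range 1 i) (λ a → hits δ p 0 a c rs) ≤ i
  byLabel = begin
    ∑ (range 1 i) (λ a → hits δ p 0 a c rs) ≤⟨ ∑-≤length (range 1 i) (λ a → hits≤1 δ p 0 a c chain) ⟩
    length (range 1 i)                      ≡⟨ length-applyUpTo suc i ⟩
    i                                       ∎
  once : ∀ q → ∑ (range 1 i) (λ a → 𝟙 (selected a c q)) ≤ 𝟙 (inCol (proj₁ (proj₂ q)) c)
  once (s , r) with inCol (proj₁ r) c
  ... | false = ≤-reflexive (∑-zero (range 1 i) λ _ → refl)
  ... | true  = ≤-trans (≤-reflexive (sym (countᵇ-∑ (λ a → entry r c ≡ᵇ a + s) (range 1 i))))
    (countᵇ≤1 (range-unique i) λ {a} {b} ta tb → +-cancelʳ-≡ s a b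
      (trans (sym (≡ᵇ⇒≡ (entry r c) (a + s) ta)) (≡ᵇ⇒≡ (entry r c) (b + s) tb)))
  byRow : ∑ (range 1 i) (λ a → hits δ p 0 a c rs) ≤ height (keep δ p (shape rs)) c
  byRow = begin
    ∑ (range 1 i) (λ a → hits δ p 0 a c rs)
      ≡⟨ ∑-swap (range 1 i) (shifted δ p 0 rs) (λ a → 𝟙 ∘ selected a c) ⟩
    ∑ (shifted δ p 0 rs) (λ q → ∑ (range 1 i) (λ a → 𝟙 (selected a c q)))
      ≤⟨ ∑-mono (shifted δ p 0 rs) (λ {q} _ → once q) ⟩
    ∑ (shifted δ p 0 rs) (λ q → 𝟙 (inCol (proj₁ (proj₂ q)) c))
      ≡⟨ ∑-map proj₂ (shifted δ p 0 rs) ⟨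
    ∑ (map proj₂ (shifted δ p 0 rs)) (λ r → 𝟙 (inCol (proj₁ r) c))
      ≡⟨ cong (λ xs → ∑ xs (λ r → 𝟙 (inCol (proj₁ r) c))) (shifted-keep δ p 0 rs) ⟩
    ∑ (keep δ p rs) (λ r → 𝟙 (inCol (proj₁ r) c))
      ≡⟨ ∑-map proj₁ (keep δ p rs) ⟨
    height (shape (keep δ p rs)) c
      ≡⟨ cong (λ sh → height sh c) (keep-map δ p proj₁ rs) ⟨
    height (keep δ p (shape rs)) c ∎

-- Summing by columns reduces the claim to `column-hits`; the minimum is then expanded again as a
-- sum over the labels `a` not exceeding the height.
occ-bound : ∀ δ p i {rs} → All Fits rs → Linked _above_ rs →
  ∑ (range 1 i) (λ a → ∑ (shifted δ p 0 rs) (λ q → occ (a + proj₁ q) (proj₂ q)))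
    ≤ ∑ (range 1 i) (conj (keep δ p (shape rs)))
occ-bound δ p i {rs} fits chain = begin
  ∑ I (λ a → ∑ S (λ q → occ (a + proj₁ q) (proj₂ q)))
    ≡⟨ ∑-cong I (λ {a} _ → ∑-cong S (λ {q} q∈ → countᵇ-row (_≡ᵇ a + proj₁ q) _ (proj₂ q)
         (All.lookup (All-shifted δ p 0 fits) q∈) (All.lookup wide q∈))) ⟩
  ∑ I (λ a → ∑ S (λ q → ∑ C (λ c → 𝟙 (selected a c q))))
    ≡⟨ ∑-cong I (λ {a} _ → ∑-swap S C (λ q c → 𝟙 (selected a c q))) ⟩
  ∑ I (λ a → ∑ C (λ c → hits δ p 0 a c rs))
    ≡⟨ ∑-swap I C (λ a c → hits δ p 0 a c rs) ⟩
  ∑ C (λ c → ∑ I (λ a → hits δ p 0 a c rs))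
    ≤⟨ ∑-mono C (λ {c} _ → column-hits δ p c i chain) ⟩
  ∑ C (λ c → i ⊓ height sh c)
    ≡⟨ ∑-cong C (λ {c} _ → ∑-≤ᵇ i (height sh c)) ⟨
  ∑ C (λ c → ∑ I (λ a → 𝟙 (a ≤ᵇ height sh c)))
    ≡⟨ ∑-swap I C (λ a c → 𝟙 (a ≤ᵇ height sh c)) ⟨
  ∑ I (conj sh) ∎
  where
  open ≤-Reasoning
  sh = keep δ p (shape rs)
  I = range 1 i
  C = columns sh
  S = shifted δ p 0 rs
  -- The columns of the shape after deletion contain every kept row, as `countᵇ-row` requires.
  wide : All (λ q → proj₁ (proj₁ (proj₂ q)) ≤ maxList (outer sh)) S
  wide = All.map⁻ {xs = S} (All.map⁻ (subst (All _) same (maxList-upper sh)))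
    where
    same : sh ≡ shape (map proj₂ S)
    same = trans (keep-map δ p proj₁ rs) (cong shape (sym (shifted-keep δ p 0 rs)))

-- The Boolean tests of isLRᵇ

⇒ᵇ⁻ : ∀ x {y} → T (not x ∨ y) → T x → T y
⇒ᵇ⁻ true t _ = t

⇒ᵇ⁺ : ∀ x {y} → (T x → T y) → T (not x ∨ y)
⇒ᵇ⁺ true  f = f tt
⇒ᵇ⁺ false f = tt

sortedᵇ⁻ : ∀ w → T (sortedᵇ w) → Linked _≤_ w
sortedᵇ⁻ []          _ = []
sortedᵇ⁻ (x ∷ [])    _ = [-]
sortedᵇ⁻ (x ∷ y ∷ w) t =
  ≤ᵇ⁻ x y (proj₁ (∧⁻ (x ≤ᵇ y) t)) ∷ sortedᵇ⁻ (y ∷ w) (proj₂ (∧⁻ (x ≤ᵇ y) t))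

sortedᵇ⁺ : ∀ {w} → Linked _≤_ w → T (sortedᵇ w)
sortedᵇ⁺ []                      = tt
sortedᵇ⁺ [-]                     = tt
sortedᵇ⁺ (_∷_ {x} {y} x≤y chain) = ∧⁺ (x ≤ᵇ y) (≤ᵇ⁺ x≤y) (sortedᵇ⁺ chain)

shapeOKᵇ⁻ : ∀ sh ws → T (shapeOKᵇ (outer sh) (inner sh) ws) →
  ∃ λ rs → shape rs ≡ sh × map proj₂ rs ≡ ws × All Fits rs
shapeOKᵇ⁻ []             []       _ = [] , refl , refl , []
shapeOKᵇ⁻ ((g , l) ∷ sh) (w ∷ ws) t
  with fit , t′ ← ∧⁻ (length w ≡ᵇ (g ∸ l)) t
  with rs , refl , refl , fits ← shapeOKᵇ⁻ sh ws t′ =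
  ((g , l) , w) ∷ rs , refl , refl , ≡ᵇ⇒≡ _ _ fit ∷ fits

shapeOKᵇ⁺ : ∀ {rs} → All Fits rs → T (shapeOKᵇ (outer (shape rs)) (inner (shape rs)) (map proj₂ rs))
shapeOKᵇ⁺ []           = tt
shapeOKᵇ⁺ {((g , l) , w) ∷ _} (fit ∷ fits) =
  ∧⁺ (length w ≡ᵇ (g ∸ l)) (≡⇒≡ᵇ (length w) (g ∸ l) fit) (shapeOKᵇ⁺ fits)

_⊒_ : ℕ × ℕ → ℕ × ℕ → Set
p ⊒ q = proj₁ q ≤ proj₁ p × proj₂ q ≤ proj₂ p

colStrictᵇ⁻ : ∀ K rs → All (λ p → proj₁ p ≤ K) (shape rs) → Linked _⊒_ (shape rs) →
  T (colStrictᵇ K (outer (shape rs)) (inner (shape rs)) (map proj₂ rs)) → Linked _above_ rs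
colStrictᵇ⁻ K []           _            _                     _ = []
colStrictᵇ⁻ K (r ∷ [])     _            _                     _ = [-]
colStrictᵇ⁻ K (r@((g , l) , w) ∷ r′@((g′ , l′) , w′) ∷ rs) (g≤K ∷ bound) ((g′≤g , l′≤l) ∷ chain) t
  with strict , t′ ← ∧⁻ (all (λ c → not ((l <ᵇ c) ∧ (c ≤ᵇ g) ∧ (l′ <ᵇ c) ∧ (c ≤ᵇ g′))
                               ∨ (at w (c ∸ l ∸ 1) <ᵇ at w′ (c ∸ l′ ∸ 1))) (range 1 K)) t =
  (g′≤g , l′≤l , increase) ∷ colStrictᵇ⁻ K (r′ ∷ rs) bound chain t′
  where
  increase : ∀ c → T (inCol (g , l) c) → T (inCol (g′ , l′) c) → entry r c < entry r′ c
  increase c r∋c r′∋c with l<c , c≤g ← ∧⁻ (l <ᵇ c) r∋c =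
    <ᵇ⇒< _ _ (⇒ᵇ⁻ ((l <ᵇ c) ∧ (c ≤ᵇ g) ∧ (l′ <ᵇ c) ∧ (c ≤ᵇ g′))
      (All.lookup (All.all⁺ _ (range 1 K) strict)
        (∈-range⁺ (≤-trans (s≤s z≤n) (<ᵇ⇒< l c l<c)) (≤-trans (≤ᵇ⁻ c g c≤g) g≤K)))
      (∧⁺ (l <ᵇ c) l<c (∧⁺ (c ≤ᵇ g) c≤g r′∋c)))

colStrictᵇ⁺ : ∀ K rs → Linked _above_ rs →
  T (colStrictᵇ K (outer (shape rs)) (inner (shape rs)) (map proj₂ rs))
colStrictᵇ⁺ K []       _   = tt
colStrictᵇ⁺ K (r ∷ []) [-] = tt
colStrictᵇ⁺ K (((g , l) , w) ∷ ((g′ , l′) , w′) ∷ rs) ((_ , _ , increase) ∷ chain) =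
  ∧⁺ (all (λ c → not ((l <ᵇ c) ∧ (c ≤ᵇ g) ∧ (l′ <ᵇ c) ∧ (c ≤ᵇ g′))
                               ∨ (at w (c ∸ l ∸ 1) <ᵇ at w′ (c ∸ l′ ∸ 1))) (range 1 K))
    (All.all⁻ _ {range 1 K} (All.universal (λ c → ⇒ᵇ⁺ ((l <ᵇ c) ∧ (c ≤ᵇ g) ∧ (l′ <ᵇ c) ∧ (c ≤ᵇ g′)) (strict c)) _))
    (colStrictᵇ⁺ K (((g′ , l′) , w′) ∷ rs) chain)
  where
  strict : ∀ c → T ((l <ᵇ c) ∧ (c ≤ᵇ g) ∧ (l′ <ᵇ c) ∧ (c ≤ᵇ g′)) →
    T (at w (c ∸ l ∸ 1) <ᵇ at w′ (c ∸ l′ ∸ 1))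
  strict c t with l<c , t′ ← ∧⁻ (l <ᵇ c) t with c≤g , r′∋c ← ∧⁻ (c ≤ᵇ g) t′ =
    <⇒<ᵇ (increase c (∧⁺ (l <ᵇ c) l<c c≤g) r′∋c)

-- The counts are demanded for all positive labels; beyond `length mu` both sides are zero.
Content : List ℕ → List ℕ → Set
Content mu word =
  All (λ a → 1 ≤ a × a ≤ length mu) word × (∀ a → countᵇ (_≡ᵇ suc a) word ≡ part mu (suc a))

contentᵇ⁻ : ∀ mu word → T (contentᵇ mu word) → Content mu word
contentᵇ⁻ mu word t with inside , counts ← ∧⁻ (all (λ a → (1 ≤ᵇ a) ∧ (a ≤ᵇ length mu)) word) t =
  bounds , count
  where
  bounds : All (λ a → 1 ≤ a × a ≤ length mu) word
  bounds = All.map (λ {a} t → let 1≤a , a≤m = ∧⁻ (1 ≤ᵇ a) t in ≤ᵇ⁻ 1 a 1≤a , ≤ᵇ⁻ a _ a≤m)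
    (All.all⁺ _ word inside)
  count : ∀ a → countᵇ (_≡ᵇ suc a) word ≡ part mu (suc a)
  count a with suc a ≤? length mu
  ... | yes a<m = ≡ᵇ⇒≡ _ _ (All.lookup (All.all⁺ _ (range 1 (length mu)) counts) (∈-range⁺ (s≤s z≤n) a<m))
  ... | no  a≮m = trans
    (countᵇ-none (All.map (λ {x} (_ , x≤m) x≡a → a≮m (subst (_≤ length mu) (≡ᵇ⇒≡ x (suc a) x≡a) x≤m)) bounds))
    (sym (part-[] {mu} (suc a) (≰⇒> a≮m)))

contentᵇ⁺ : ∀ mu word → Content mu word → T (contentᵇ mu word)
contentᵇ⁺ mu word (bounds , count) = ∧⁺ (all (λ a → (1 ≤ᵇ a) ∧ (a ≤ᵇ length mu)) word)
  (All.all⁻ _ (All.map (λ {a} (1≤a , a≤m) → ∧⁺ (1 ≤ᵇ a) (≤ᵇ⁺ 1≤a) (≤ᵇ⁺ a≤m)) bounds))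
  (All.all⁻ _ (All.applyUpTo⁺₂ suc (length mu) λ a → ≡⇒≡ᵇ _ _ (count a)))

-- Lattice words and the row-by-row lattice condition

Ballot : List ℕ → Set
Ballot u = ∀ b → 1 ≤ b → countᵇ (_≡ᵇ suc b) u ≤ countᵇ (_≡ᵇ b) u

∈-inits⁺ : ∀ (u v : List A) → u ∈ inits (u ++ v)
∈-inits⁺ []      v = here refl
∈-inits⁺ (x ∷ u) v = there (∈-map⁺ (x ∷_) (∈-inits⁺ u v))

inits-prefix : ∀ (w : List A) → All (λ u → ∃ λ v → w ≡ u ++ v) (inits w)
inits-prefix []      = ([] , refl) ∷ []
inits-prefix (x ∷ w) = (x ∷ w , refl) ∷
  All.map⁺ (All.map (λ (v , eq) → v , cong (x ∷_) eq) (inits-prefix w))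

∈⇒≤maxList : ∀ {x w} → x ∈ w → x ≤ maxList w
∈⇒≤maxList {w = x ∷ w} (here refl) = m≤m⊔n x _
∈⇒≤maxList {w = y ∷ w} (there x∈w) = ≤-trans (∈⇒≤maxList x∈w) (m≤n⊔m y _)

latticeᵇ⁻ : ∀ word → T (latticeᵇ word) → ∀ u v → word ≡ u ++ v → Ballot u
latticeᵇ⁻ word t u v refl b 1≤b with suc b ≤? maxList word
... | yes b<m = ≤ᵇ⁻ (countᵇ (_≡ᵇ suc b) u) _ (All.lookup
  (All.all⁺ _ (range 2 (maxList word)) (All.lookup (All.all⁺ _ (inits word) t) (∈-inits⁺ u v))) (∈-range₂ 1≤b b<m))
  where
  ∈-range₂ : ∀ {b m} → 1 ≤ b → suc b ≤ m → suc b ∈ range 2 m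
  ∈-range₂ {suc b} (s≤s _) (s≤s b<m) = ∈-applyUpTo⁺ (2 +_) b<m
-- The test stops at the largest label of the word; a greater label does not occur in any prefix.
... | no b≮m = ≤-trans (≤-reflexive (countᵇ-none {xs = u} (All.tabulate λ {x} x∈u x≡b →
  b≮m (subst (_≤ maxList word) (≡ᵇ⇒≡ x (suc b) x≡b) (∈⇒≤maxList {w = word} (∈-++⁺ˡ x∈u)))))) z≤n

latticeᵇ⁺ : ∀ word → (∀ u v → word ≡ u ++ v → Ballot u) → T (latticeᵇ word)
latticeᵇ⁺ word ballot = All.all⁻ _ (All.map
  (λ {u} (v , eq) → All.all⁻ _ (All.applyUpTo⁺₂ (2 +_) (maxList word ∸ 1) λ i →
    ≤ᵇ⁺ {countᵇ (_≡ᵇ suc (suc i)) u} (ballot u v eq (suc i) (s≤s z≤n))))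
  (inits-prefix word))

countᵇ-reverse : ∀ (p : A → Bool) xs → countᵇ p (reverse xs) ≡ countᵇ p xs
countᵇ-reverse p xs = begin
  countᵇ p (reverse xs) ≡⟨ countᵇ-∑ p (reverse xs) ⟩
  ∑ (reverse xs) (𝟙 ∘ p) ≡⟨ sum-↭ (↭-map⁺ (𝟙 ∘ p) (↭-reverse xs)) ⟩
  ∑ xs (𝟙 ∘ p)           ≡⟨ countᵇ-∑ p xs ⟨
  countᵇ p xs ∎
  where open ≡-Reasoning

Lattice-cong : ∀ {f g : ℕ → ℕ} rs → (∀ b → 1 ≤ b → f b ≡ g b) → Lattice f rs → Lattice g rs
Lattice-cong []       f≗g _ = tt
Lattice-cong {f} {g} (r ∷ rs) f≗g (lat₁ , lat) = lat₁′ ,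
  Lattice-cong rs (λ b 1≤b → cong (_+ occ b r) (f≗g b 1≤b)) lat
  where
  lat₁′ : ∀ b → 1 ≤ b → g (suc b) + occ (suc b) r ≤ g b
  lat₁′ b 1≤b rewrite sym (f≗g b 1≤b) | sym (f≗g (suc b) (s≤s z≤n)) = lat₁ b 1≤b

split-sorted : ∀ b {w} → Linked _≤_ w → ∃₂ λ u v → w ≡ u ++ v × All (_≤ b) u × All (b <_) v
split-sorted b {[]}    _     = [] , [] , refl , [] , []
split-sorted b {x ∷ w} chain with x ≤? b
... | no  x≰b = [] , x ∷ w , refl , [] ,
  All.map (≤-trans (≰⇒> x≰b)) (Linked.Linked⇒All ≤-trans ≤-refl chain)
... | yes x≤b with u , v , refl , u≤b , b<v ← split-sorted b (Linked.tail chain) =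
  x ∷ u , v , refl , x≤b ∷ u≤b , b<v

-- A row is read from right to left, so all its entries suc b come before its entries b.
ballot⇒Lattice : ∀ pre rs → All (Linked _≤_ ∘ proj₂) rs →
  (∀ u v → pre ++ revRowWord (map proj₂ rs) ≡ u ++ v → Ballot u) →
  Lattice (λ b → countᵇ (_≡ᵇ b) pre) rs
ballot⇒Lattice pre []              _                 _      = tt
ballot⇒Lattice pre (r@(_ , w) ∷ rs) (sorted ∷ sorteds) ballot = first ,
  Lattice-cong rs
    (λ b _ → trans (countᵇ-++ (_≡ᵇ b) pre (reverse w)) (cong (countᵇ (_≡ᵇ b) pre +_) (countᵇ-reverse (_≡ᵇ b) w)))
    (ballot⇒Lattice (pre ++ reverse w) rs sorteds
      λ u v eq → ballot u v (trans (sym (++-assoc pre (reverse w) _)) eq))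
  where
  first : ∀ b → 1 ≤ b → countᵇ (_≡ᵇ suc b) pre + occ (suc b) r ≤ countᵇ (_≡ᵇ b) pre
  first b 1≤b with u , v , refl , u≤b , b<v ← split-sorted b sorted = begin
    countᵇ (_≡ᵇ suc b) pre + countᵇ (_≡ᵇ suc b) (u ++ v)
      ≡⟨ cong (countᵇ (_≡ᵇ suc b) pre +_) (countᵇ-++ (_≡ᵇ suc b) u v) ⟩
    countᵇ (_≡ᵇ suc b) pre + (countᵇ (_≡ᵇ suc b) u + countᵇ (_≡ᵇ suc b) v)
      ≡⟨ cong (λ n → countᵇ (_≡ᵇ suc b) pre + (n + countᵇ (_≡ᵇ suc b) v))
           (countᵇ-none (All.map (λ {x} x≤b x≡ → <⇒≱ (s≤s x≤b) (≤-reflexive (sym (≡ᵇ⇒≡ x (suc b) x≡)))) u≤b)) ⟩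
    countᵇ (_≡ᵇ suc b) pre + countᵇ (_≡ᵇ suc b) v
      ≡⟨ count-pre (suc b) v ⟨
    countᵇ (_≡ᵇ suc b) (pre ++ reverse v)
      -- The prefix stops after the entries greater than `b`: it has read every `suc b` of the row
      -- and no `b` of it.
      ≤⟨ ballot (pre ++ reverse v) (reverse u ++ revRowWord (map proj₂ rs)) factor b 1≤b ⟩
    countᵇ (_≡ᵇ b) (pre ++ reverse v)
      ≡⟨ count-pre b v ⟩
    countᵇ (_≡ᵇ b) pre + countᵇ (_≡ᵇ b) v
      ≡⟨ cong (countᵇ (_≡ᵇ b) pre +_)
           (countᵇ-none (All.map (λ {x} b<x x≡ → <⇒≢ b<x (sym (≡ᵇ⇒≡ x b x≡))) b<v)) ⟩
    countᵇ (_≡ᵇ b) pre + 0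
      ≡⟨ +-identityʳ _ ⟩
    countᵇ (_≡ᵇ b) pre ∎
    where
    open ≤-Reasoning
    count-pre : ∀ b v → countᵇ (_≡ᵇ b) (pre ++ reverse v) ≡ countᵇ (_≡ᵇ b) pre + countᵇ (_≡ᵇ b) v
    count-pre b v = trans (countᵇ-++ (_≡ᵇ b) pre (reverse v))
      (cong (countᵇ (_≡ᵇ b) pre +_) (countᵇ-reverse (_≡ᵇ b) v))
    factor : pre ++ reverse (u ++ v) ++ revRowWord (map proj₂ rs) ≡
             (pre ++ reverse v) ++ reverse u ++ revRowWord (map proj₂ rs)
    factor rewrite reverse-++ u v | ++-assoc (reverse v) (reverse u) (revRowWord (map proj₂ rs)) =
      sym (++-assoc pre (reverse v) _)

++-split : ∀ (xs : List A) {ys u v} → xs ++ ys ≡ u ++ v →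
  (∃ λ w → u ≡ xs ++ w × ys ≡ w ++ v) ⊎ (∃ λ w → xs ≡ u ++ w)
++-split []       {u = u}     eq = inj₁ (u , refl , eq)
++-split (x ∷ xs) {u = []}    eq = inj₂ (x ∷ xs , refl)
++-split (x ∷ xs) {u = y ∷ u} eq with refl , eq′ ← ∷-injective eq with ++-split xs {u = u} eq′
... | inj₁ (w , refl , eq″) = inj₁ (w , refl , eq″)
... | inj₂ (w , refl)       = inj₂ (w , refl)

-- Complete rows are moved into `pre`. In the row where the prefix ends, the entries `suc b` read so
-- far are at most those of the whole row, and the row condition bounds these using only the entries
-- `b` of earlier rows.
Lattice⇒ballot : ∀ pre rs → Lattice (λ b → countᵇ (_≡ᵇ b) pre) rs → Ballot pre →
  ∀ u v → revRowWord (map proj₂ rs) ≡ u ++ v → Ballot (pre ++ u)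
Lattice⇒ballot pre []              _            ballot [] v eq rewrite ++-identityʳ pre = ballot
Lattice⇒ballot pre (r@(_ , w) ∷ rs) (lat₁ , lat) ballot u v eq with ++-split (reverse w) {u = u} eq
... | inj₁ (u′ , refl , eq′) = subst Ballot (++-assoc pre (reverse w) u′)
  (Lattice⇒ballot (pre ++ reverse w) rs (Lattice-cong rs (λ b _ → sym (count-pre b)) lat) ballot′ u′ v eq′)
  where
  count-pre : ∀ b → countᵇ (_≡ᵇ b) (pre ++ reverse w) ≡ countᵇ (_≡ᵇ b) pre + occ b r
  count-pre b = trans (countᵇ-++ (_≡ᵇ b) pre (reverse w))
    (cong (countᵇ (_≡ᵇ b) pre +_) (countᵇ-reverse (_≡ᵇ b) w))
  ballot′ : Ballot (pre ++ reverse w)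
  ballot′ b 1≤b rewrite count-pre b | count-pre (suc b) = ≤-trans (lat₁ b 1≤b) (m≤m+n _ _)
... | inj₂ (u′ , eq′) = λ b 1≤b → begin
  countᵇ (_≡ᵇ suc b) (pre ++ u)                        ≡⟨ countᵇ-++ (_≡ᵇ suc b) pre u ⟩
  countᵇ (_≡ᵇ suc b) pre + countᵇ (_≡ᵇ suc b) u        ≤⟨ +-monoʳ-≤ (countᵇ (_≡ᵇ suc b) pre) (within (suc b)) ⟩
  countᵇ (_≡ᵇ suc b) pre + occ (suc b) r               ≤⟨ lat₁ b 1≤b ⟩
  countᵇ (_≡ᵇ b) pre                                   ≤⟨ m≤m+n _ _ ⟩
  countᵇ (_≡ᵇ b) pre + countᵇ (_≡ᵇ b) u                ≡⟨ countᵇ-++ (_≡ᵇ b) pre u ⟨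
  countᵇ (_≡ᵇ b) (pre ++ u)                            ∎
  where
  open ≤-Reasoning
  within : ∀ b → countᵇ (_≡ᵇ b) u ≤ occ b r
  within b = begin
    countᵇ (_≡ᵇ b) u                        ≤⟨ m≤m+n _ _ ⟩
    countᵇ (_≡ᵇ b) u + countᵇ (_≡ᵇ b) u′    ≡⟨ countᵇ-++ (_≡ᵇ b) u u′ ⟨
    countᵇ (_≡ᵇ b) (u ++ u′)                ≡⟨ cong (countᵇ (_≡ᵇ b)) eq′ ⟨
    countᵇ (_≡ᵇ b) (reverse w)              ≡⟨ countᵇ-reverse (_≡ᵇ b) w ⟩
    occ b r                                 ∎

-- The conditions of `isLRᵇ` as propositions, with the lattice word replaced by its row-by-row form.
record LRTableau (mu : List ℕ) (rs : List Row) : Set where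
  field
    fits    : All Fits rs
    sorted  : All (Linked _≤_ ∘ proj₂) rs
    chain   : Linked _above_ rs
    content : Content mu (concat (map proj₂ rs))
    lattice : Lattice (λ _ → 0) rs

isLRᵇ⁻ : ∀ {sh mu ws} → Linked _⊒_ sh → T (isLRᵇ (outer sh) (inner sh) mu ws) →
  ∃ λ rs → shape rs ≡ sh × map proj₂ rs ≡ ws × LRTableau mu rs
isLRᵇ⁻ {sh} {mu} {ws} desc t
  with t₁ , t ← ∧⁻ (shapeOKᵇ (outer sh) (inner sh) ws) t
  with t₂ , t ← ∧⁻ (all sortedᵇ ws) t
  with t₃ , t ← ∧⁻ (colStrictᵇ (maxList (outer sh)) (outer sh) (inner sh) ws) t
  with t₄ , t₅ ← ∧⁻ (contentᵇ mu (concat ws)) t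
  with rs , refl , refl , fits ← shapeOKᵇ⁻ sh ws t₁ = rs , refl , refl , record
  { fits    = fits
  ; sorted  = sorted
  ; chain   = colStrictᵇ⁻ (maxList (outer sh)) rs (maxList-upper sh) desc t₃
  ; content = contentᵇ⁻ mu (concat ws) t₄
  ; lattice = ballot⇒Lattice [] rs sorted (latticeᵇ⁻ (revRowWord ws) t₅)
  }
  where
  sorted : All (Linked _≤_ ∘ proj₂) rs
  sorted = All.map⁻ (All.map (λ {w} → sortedᵇ⁻ w) (All.all⁺ sortedᵇ ws t₂))

isLRᵇ⁺ : ∀ {mu rs} → LRTableau mu rs →
  T (isLRᵇ (outer (shape rs)) (inner (shape rs)) mu (map proj₂ rs))
isLRᵇ⁺ {mu} {rs} tab =
  ∧⁺ (shapeOKᵇ (outer sh) (inner sh) ws) (shapeOKᵇ⁺ fits)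
  (∧⁺ (all sortedᵇ ws) (All.all⁻ sortedᵇ (All.map⁺ (All.map sortedᵇ⁺ sorted)))
  (∧⁺ (colStrictᵇ K (outer sh) (inner sh) ws) (colStrictᵇ⁺ K rs chain)
  (∧⁺ (contentᵇ mu (concat ws)) (contentᵇ⁺ mu (concat ws) content)
    (latticeᵇ⁺ (revRowWord ws) (Lattice⇒ballot [] rs lattice (λ _ _ → z≤n))))))
  where
  open LRTableau tab
  sh = shape rs
  ws = map proj₂ rs
  K  = maxList (outer sh)

-- Dominance

antitone : ∀ (f : ℕ → ℕ) → (∀ a → f (suc a) ≤ f a) → ∀ {a b} → a ≤ b → f b ≤ f a
antitone f step {zero}  {zero}  _         = ≤-refl
antitone f step {zero}  {suc b} _         = ≤-trans (step b) (antitone f step z≤n)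
antitone f step {suc a} {suc b} (s≤s a≤b) = antitone (f ∘ suc) (step ∘ suc) a≤b

part-step : ∀ {mu} → Linked _≥_ mu → ∀ a → part mu (suc (suc a)) ≤ part mu (suc a)
part-step []              a       = z≤n
part-step [-]             a       = z≤n
part-step (y≤x ∷ chain)   zero    = y≤x
part-step (y≤x ∷ chain)   (suc a) = part-step chain a

count-content : ∀ {mu rs} → LRTableau mu rs → ∀ a → part mu (suc a) ≡ ∑ rs (occ (suc a))
count-content {mu} {rs} tab a = begin
  part mu (suc a)                                  ≡⟨ proj₂ (LRTableau.content tab) a ⟨
  countᵇ (_≡ᵇ suc a) (concat (map proj₂ rs))       ≡⟨ countᵇ-concat (_≡ᵇ suc a) (map proj₂ rs) ⟩
  ∑ (map proj₂ rs) (countᵇ (_≡ᵇ suc a))            ≡⟨ ∑-map proj₂ rs ⟩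
  ∑ rs (occ (suc a))                               ∎
  where open ≡-Reasoning

-- `cover` bounds each part of `mu`, moved by the number of deleted rows, by entries in kept rows;
-- `occ-bound` then bounds the partial sums. The empty `I` gives the bound for the undeleted shape.
dominated : ∀ {mu rs} → Linked _≥_ mu → LRTableau mu rs → ∀ I →
  let sh = keep (hit I) 1 (shape rs) in drop (length I) mu ≤GDom std (outer sh) (inner sh)
dominated {mu} {rs} desc tab I = ≤GDom⁺ λ i → begin
  ∑ (range 1 i) (part (drop (length I) mu))
    ≤⟨ ∑-mono (range 1 i) (λ {a} → termwise a) ⟩
  ∑ (range 1 i) (λ a → ∑ (shifted (hit I) 1 0 rs) (λ q → occ (a + proj₁ q) (proj₂ q)))
    ≤⟨ occ-bound (hit I) 1 i fits chain ⟩
  ∑ (range 1 i) (conj sh)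
    ≡⟨ ∑-cong (range 1 i) (λ {a} → conj-part a) ⟩
  ∑ (range 1 i) (part (std (outer sh) (inner sh))) ∎
  where
  open ≤-Reasoning
  open LRTableau tab
  sh = keep (hit I) 1 (shape rs)
  f  = finalShift (hit I) 1 0 rs
  f≤ : f ≤ length I
  f≤ = ≤-trans (finalShift≤ I 1 0 rs) (∑-≤length I λ i → 𝟙≤1 (1 ≤ᵇ i))
  conj-part : ∀ {i} a → a ∈ range 1 i → conj sh a ≡ part (std (outer sh) (inner sh)) a
  conj-part zero    a∈ = contradiction (proj₁ (∈-range⁻ a∈)) λ ()
  conj-part (suc a) _  = sym (part-std sh a)
  termwise : ∀ {i} a → a ∈ range 1 i → part (drop (length I) mu) a ≤
    ∑ (shifted (hit I) 1 0 rs) (λ q → occ (a + proj₁ q) (proj₂ q))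
  termwise zero    a∈ = contradiction (proj₁ (∈-range⁻ a∈)) λ ()
  termwise (suc a) _  = begin
    part (drop (length I) mu) (suc a)  ≡⟨ part-drop (length I) mu a ⟩
    -- Here `f` is the number of rows actually deleted. It is at most `length I`, and the parts of
    -- `mu` decrease.
    part mu (suc (a + length I))       ≤⟨ antitone (part mu ∘ suc) (part-step desc) (+-monoʳ-≤ a f≤) ⟩
    part mu (suc (a + f))              ≡⟨ count-content tab (a + f) ⟩
    ∑ rs (occ (suc (a + f)))           ≤⟨ cover (hit I) 1 0 (λ _ → 0) (λ _ → 0) rs lattice (λ _ _ → z≤n) (suc a) (s≤s z≤n) ⟩
    ∑ (shifted (hit I) 1 0 rs) (λ q → occ (suc a + proj₁ q) (proj₂ q)) ∎

-- The canonical tableau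

-- acc c is the number of cells of column c in the rows above.
_⊕_ : (ℕ → ℕ) → ℕ × ℕ → ℕ → ℕ
(acc ⊕ p) c = acc c + 𝟙 (inCol p c)

-- Position `k`, counted from 0, lies in column `suc (l + k)`; its label is its depth in that
-- column, counted from 1.
canonRow : (ℕ → ℕ) → ℕ × ℕ → Row
canonRow acc p@(g , l) = p , applyUpTo (λ k → suc (acc (suc (l + k)))) (g ∸ l)

canon : (ℕ → ℕ) → Shape → List Row
canon acc []       = []
canon acc (p ∷ sh) = canonRow acc p ∷ canon (acc ⊕ p) sh

at-applyUpTo : ∀ f {n k} → k < n → at (applyUpTo f n) k ≡ f k
at-applyUpTo f {suc n} {zero}  _         = refl
at-applyUpTo f {suc n} {suc k} (s≤s k<n) = at-applyUpTo (f ∘ suc) k<n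

at-All : ∀ {P : ℕ → Set} {w k} → All P w → k < length w → P (at w k)
at-All {k = zero}  (px ∷ _)   _         = px
at-All {k = suc k} (_  ∷ pxs) (s≤s k<n) = at-All pxs k<n

-- Inside the row the truncated subtractions in `entry` are exact, so column and position determine
-- each other.
inCol-index : ∀ g l c → T (inCol (g , l) c) → c ∸ l ∸ 1 < g ∸ l × suc (l + (c ∸ l ∸ 1)) ≡ c
inCol-index g       (suc l) zero    ()
inCol-index zero    (suc l) (suc c) t =
  contradiction (proj₂ (inCol⁻ (0 , suc l) {suc c} t)) λ ()
inCol-index (suc g) (suc l) (suc c) t with k< , eq ← inCol-index g l c t = k< , cong suc eq
inCol-index g       zero    (suc c) t = ≤ᵇ⁻ (suc c) g t , refl

canon-entry : ∀ acc p {c} → T (inCol p c) → entry (canonRow acc p) c ≡ suc (acc c)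
canon-entry acc p@(g , l) {c} t with k< , eq ← inCol-index g l c t =
  trans (at-applyUpTo _ k<) (cong (suc ∘ acc) eq)

shape-canon : ∀ acc sh → shape (canon acc sh) ≡ sh
shape-canon acc []       = refl
shape-canon acc (p ∷ sh) = cong (p ∷_) (shape-canon (acc ⊕ p) sh)

canon-fits : ∀ acc sh → All Fits (canon acc sh)
canon-fits acc []             = []
canon-fits acc ((g , l) ∷ sh) =
  length-applyUpTo (λ k → suc (acc (suc (l + k)))) (g ∸ l) ∷ canon-fits (acc ⊕ (g , l)) sh

canon-chain : ∀ acc {sh} → Linked _⊒_ sh → Linked _above_ (canon acc sh)
canon-chain acc []  = []
canon-chain acc [-] = [-]
canon-chain acc (_∷_ {p} {p′} (g′≤g , l′≤l) desc) =
  (g′≤g , l′≤l , increase) ∷ canon-chain (acc ⊕ p) desc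
  where
  increase : ∀ c → T (inCol p c) → T (inCol p′ c) →
    entry (canonRow acc p) c < entry (canonRow (acc ⊕ p) p′) c
  increase c t t′ = begin-strict
    entry (canonRow acc p) c         ≡⟨ canon-entry acc p {c} t ⟩
    suc (acc c)                      ≡⟨ +-comm (acc c) 1 ⟨
    acc c + 1                        ≡⟨ cong (acc c +_) (𝟙-true t) ⟨
    (acc ⊕ p) c                      <⟨ n<1+n _ ⟩
    suc ((acc ⊕ p) c)                ≡⟨ canon-entry (acc ⊕ p) p′ {c} t′ ⟨
    entry (canonRow (acc ⊕ p) p′) c  ∎
    where open ≤-Reasoning

-- The bound `g` matters: columns beyond the outer bound of the current row may have fewer cells
-- above than columns to their left.
MonoUpTo : ℕ → (ℕ → ℕ) → Set
MonoUpTo g acc = ∀ c → suc c ≤ g → acc c ≤ acc (suc c)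

k<m∸n⇒n+k<m : ∀ n {k m} → k < m ∸ n → n + k < m
k<m∸n⇒n+k<m zero            k<m = k<m
k<m∸n⇒n+k<m (suc n) {m = suc m} k<m = s≤s (k<m∸n⇒n+k<m n k<m)

-- All rows above reach at least as far right as the current one. Up to its outer bound, a row above
-- can therefore miss a column only on the left, so the number of cells above grows to the right.
canon-sorted : ∀ acc {p sh} → Linked _⊒_ (p ∷ sh) → MonoUpTo (proj₁ p) acc →
  All (Linked _≤_ ∘ proj₂) (canon acc (p ∷ sh))
canon-sorted acc {g , l} {sh} desc mono = Linked.applyUpTo⁺₁ _ (g ∸ l) step ∷ rest desc
  where
  step : ∀ {k} → suc k < g ∸ l → suc (acc (suc (l + k))) ≤ suc (acc (suc (l + suc k)))
  step {k} k+1< rewrite +-suc l k =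
    s≤s (mono (suc (l + k)) (subst (λ n → suc n ≤ g) (+-suc l k) (k<m∸n⇒n+k<m l k+1<)))
  rest : ∀ {sh} → Linked _⊒_ ((g , l) ∷ sh) → All (Linked _≤_ ∘ proj₂) (canon (acc ⊕ (g , l)) sh)
  rest [-] = []
  rest (_∷_ {y = p′} (g′≤g , _) desc) = canon-sorted (acc ⊕ (g , l)) desc mono′
    where
    mono′ : MonoUpTo (proj₁ p′) (acc ⊕ (g , l))
    mono′ c c<g′ = +-mono-≤ (mono c c<g) (𝟙-mono λ t → inCol⁺ (g , l)
      (≤-trans (proj₁ (inCol⁻ (g , l) {c} t)) (n≤1+n c)) c<g)
      where c<g = ≤-trans c<g′ g′≤g

module _ (K : ℕ) where

  -- The number of columns that have reached height a, hence the number of labels a so far.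
  full : (ℕ → ℕ) → ℕ → ℕ
  full acc a = ∑ (range 1 K) (λ c → 𝟙 (a ≤ᵇ acc c))

  -- A new cell is labelled by the new height of its column, so the column starts to count for `a`
  -- exactly when that label is `a`.
  full-step : ∀ acc p a → proj₁ p ≤ K → full acc a + occ a (canonRow acc p) ≡ full (acc ⊕ p) a
  full-step acc p@(g , l) a g≤K = begin
    full acc a + occ a r
      ≡⟨ cong (full acc a +_) (countᵇ-row (_≡ᵇ a) K r
           (length-applyUpTo (λ k → suc (acc (suc (l + k)))) (g ∸ l)) g≤K) ⟩
    full acc a + ∑ (range 1 K) (λ c → 𝟙 (inCol p c ∧ (entry r c ≡ᵇ a)))
      ≡⟨ ∑-+ (range 1 K) _ _ ⟨
    ∑ (range 1 K) (λ c → 𝟙 (a ≤ᵇ acc c) + 𝟙 (inCol p c ∧ (entry r c ≡ᵇ a)))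
      ≡⟨ ∑-cong (range 1 K) (λ {c} _ → pointwise c) ⟩
    full (acc ⊕ p) a ∎
    where
    open ≡-Reasoning
    r = canonRow acc p
    ≤ᵇ-suc : ∀ m n → 𝟙 (m ≤ᵇ n) + 𝟙 (suc n ≡ᵇ m) ≡ 𝟙 (m ≤ᵇ (n + 1))
    ≤ᵇ-suc zero          n       = refl
    ≤ᵇ-suc (suc zero)    zero    = refl
    ≤ᵇ-suc (suc (suc m)) zero    = refl
    ≤ᵇ-suc (suc m)       (suc n) = ≤ᵇ-suc m n
    pointwise : ∀ c → 𝟙 (a ≤ᵇ acc c) + 𝟙 (inCol p c ∧ (entry r c ≡ᵇ a)) ≡ 𝟙 (a ≤ᵇ (acc ⊕ p) c)
    pointwise c with inCol p c in eq
    ... | false rewrite +-identityʳ (acc c) = +-identityʳ _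
    ... | true rewrite canon-entry acc p {c} (subst T (sym eq) tt) = ≤ᵇ-suc a (acc c)

  full-canon : ∀ acc sh a → All (λ p → proj₁ p ≤ K) sh →
    full acc a + ∑ (canon acc sh) (occ a) ≡ full (λ c → acc c + height sh c) a
  full-canon acc []       a _ = trans (+-identityʳ _)
    (∑-cong (range 1 K) λ {c} _ → cong (λ n → 𝟙 (a ≤ᵇ n)) (sym (+-identityʳ (acc c))))
  full-canon acc (p ∷ sh) a (g≤K ∷ bound) = begin
    full acc a + (occ a (canonRow acc p) + ∑ (canon (acc ⊕ p) sh) (occ a))
      ≡⟨ +-assoc (full acc a) _ _ ⟨
    full acc a + occ a (canonRow acc p) + ∑ (canon (acc ⊕ p) sh) (occ a)
      ≡⟨ cong (_+ ∑ (canon (acc ⊕ p) sh) (occ a)) (full-step acc p a g≤K) ⟩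
    full (acc ⊕ p) a + ∑ (canon (acc ⊕ p) sh) (occ a)
      ≡⟨ full-canon (acc ⊕ p) sh a bound ⟩
    full (λ c → acc c + 𝟙 (inCol p c) + height sh c) a
      ≡⟨ ∑-cong (range 1 K) (λ {c} _ → cong (λ n → 𝟙 (a ≤ᵇ n)) (+-assoc (acc c) _ _)) ⟩
    full (λ c → acc c + height (p ∷ sh) c) a ∎
    where open ≡-Reasoning

  -- A row adds at most one cell to a column, so a column of height at least `suc b` after the row
  -- had height at least `b` before it.
  full-lattice : ∀ acc sh → All (λ p → proj₁ p ≤ K) sh → Lattice (full acc) (canon acc sh)
  full-lattice acc []       _             = tt
  full-lattice acc (p ∷ sh) (g≤K ∷ bound) = first ,
    Lattice-cong (canon (acc ⊕ p) sh) (λ b _ → sym (full-step acc p b g≤K)) (full-lattice (acc ⊕ p) sh bound)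
    where
    first : ∀ b → 1 ≤ b → full acc (suc b) + occ (suc b) (canonRow acc p) ≤ full acc b
    first b _ rewrite full-step acc p (suc b) g≤K = ∑-mono (range 1 K) λ {c} _ →
      𝟙-mono λ b<acc → ≤ᵇ⁺ (s≤s⁻¹ (≤-trans (≤ᵇ⁻ (suc b) _ b<acc)
        (≤-trans (+-monoʳ-≤ (acc c) (𝟙≤1 (inCol p c))) (≤-reflexive (+-comm (acc c) 1)))))

  full-zero : ∀ a → full (λ _ → 0) (suc a) ≡ 0
  full-zero a = ∑-zero (range 1 K) λ _ → refl

canon-count : ∀ sh a →
  countᵇ (_≡ᵇ suc a) (concat (map proj₂ (canon (λ _ → 0) sh))) ≡ conj sh (suc a)
canon-count sh a = begin
  countᵇ (_≡ᵇ suc a) (concat (map proj₂ R)) ≡⟨ countᵇ-concat (_≡ᵇ suc a) (map proj₂ R) ⟩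
  ∑ (map proj₂ R) (countᵇ (_≡ᵇ suc a))      ≡⟨ ∑-map proj₂ R ⟩
  ∑ R (occ (suc a))                         ≡⟨ cong (_+ ∑ R (occ (suc a))) (full-zero K a) ⟨
  full K (λ _ → 0) (suc a) + ∑ R (occ (suc a)) ≡⟨ full-canon K (λ _ → 0) sh (suc a) (maxList-upper sh) ⟩
  conj sh (suc a)                           ∎
  where
  open ≡-Reasoning
  K = maxList (outer sh)
  R = canon (λ _ → 0) sh

canon-positive : ∀ acc sh → All (All (1 ≤_)) (map proj₂ (canon acc sh))
canon-positive acc []             = []
canon-positive acc ((g , l) ∷ sh) =
  All.applyUpTo⁺₂ _ (g ∸ l) (λ _ → s≤s z≤n) ∷ canon-positive (acc ⊕ (g , l)) sh

canon-LR : ∀ {sh} → Linked _⊒_ sh → LRTableau (std (outer sh) (inner sh)) (canon (λ _ → 0) sh)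
canon-LR {sh} desc = record
  { fits    = canon-fits (λ _ → 0) sh
  ; sorted  = sorted desc
  ; chain   = canon-chain (λ _ → 0) desc
  ; content = All.tabulate bounds , count
  -- Agreement with the zero count holds for positive labels only: at label 0 every column is
  -- counted.
  ; lattice = Lattice-cong (canon (λ _ → 0) sh)
      (λ { (suc b) _ → full-zero K b }) (full-lattice K (λ _ → 0) sh (maxList-upper sh))
  }
  where
  K    = maxList (outer sh)
  mu   = std (outer sh) (inner sh)
  word = concat (map proj₂ (canon (λ _ → 0) sh))
  sorted : ∀ {sh} → Linked _⊒_ sh → All (Linked _≤_ ∘ proj₂) (canon (λ _ → 0) sh)
  sorted {[]}    _    = []
  sorted {_ ∷ _} desc = canon-sorted (λ _ → 0) desc λ _ _ → z≤n
  count : ∀ a → countᵇ (_≡ᵇ suc a) word ≡ part mu (suc a)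
  count a = trans (canon-count sh a) (sym (part-std sh a))
  bounds : ∀ {a} → a ∈ word → 1 ≤ a × a ≤ length mu
  bounds {zero}  a∈ = contradiction (All.lookup (All.concat⁺ (canon-positive (λ _ → 0) sh)) a∈) λ ()
  -- A label greater than `length mu` would have count 0, although it occurs in the word.
  bounds {suc a} a∈ = s≤s z≤n , ≮⇒≥ λ m<a → <⇒≱
    (countᵇ-some {p = _≡ᵇ suc a} a∈ (≡⇒≡ᵇ (suc a) (suc a) refl))
    (≤-reflexive (trans (count a) (part-[] {mu} (suc a) m<a)))

-- Minimality of the canonical tableau

applyUpTo-≤ : ∀ f {n w} → length w ≡ n → (∀ k → k < n → f k ≤ at w k) →
  Pointwise _≤_ (applyUpTo f n) w
applyUpTo-≤ f {zero}  {[]}    _  _  = []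
applyUpTo-≤ f {suc n} {x ∷ w} eq le =
  le 0 (s≤s z≤n) ∷ applyUpTo-≤ (f ∘ suc) (suc-injective eq) (λ k k<n → le (suc k) (s≤s k<n))


-- The induction runs down the rows with two invariants: the entries of the current row exceed the
-- number of cells above, and columns not yet reached on the left have no cells above.
canon-least : ∀ acc r rs → All Fits (r ∷ rs) → All (All (1 ≤_) ∘ proj₂) (r ∷ rs) →
  Linked _above_ (r ∷ rs) →
  (∀ c → T (inCol (proj₁ r) c) → acc c < entry r c) → (∀ c → c ≤ proj₂ (proj₁ r) → acc c ≡ 0) →
  Pointwise (Pointwise _≤_) (map proj₂ (canon acc (shape (r ∷ rs)))) (map proj₂ (r ∷ rs))
canon-least acc r@((g , l) , w) rs (fit ∷ fits) (_ ∷ pos) chain low zeros =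
  applyUpTo-≤ _ fit rowLow ∷ rest rs fits pos chain
  where
  rowLow : ∀ k → k < g ∸ l → suc (acc (suc (l + k))) ≤ at w k
  rowLow k k< = subst (λ i → acc (suc (l + k)) < at w i) index
    (low (suc (l + k)) (inCol⁺ (g , l) (s≤s (m≤m+n l k)) (k<m∸n⇒n+k<m l k<)))
    where
    index : suc (l + k) ∸ l ∸ 1 ≡ k
    index = trans (cong (λ n → n ∸ l ∸ 1) (sym (+-suc l k))) (cong (_∸ 1) (m+n∸m≡n l (suc k)))
  rest : ∀ rs → All Fits rs → All (All (1 ≤_) ∘ proj₂) rs → Linked _above_ (r ∷ rs) →
    Pointwise (Pointwise _≤_) (map proj₂ (canon (acc ⊕ (g , l)) (shape rs))) (map proj₂ rs)
  rest [] _ _ _ = []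
  rest (r′@((g′ , l′) , w′) ∷ rs) fits@(fit′ ∷ _) pos@(pos′ ∷ _) ((g′≤g , l′≤l , increase) ∷ chain) =
    canon-least (acc ⊕ (g , l)) r′ rs fits pos chain low′ zeros′
    where
    outside : ∀ c → c ≤ l → (acc ⊕ (g , l)) c ≡ 0
    outside c c≤l = cong₂ _+_ (zeros c c≤l) (𝟙-false λ t → <⇒≱ (proj₁ (inCol⁻ (g , l) {c} t)) c≤l)
    zeros′ : ∀ c → c ≤ l′ → (acc ⊕ (g , l)) c ≡ 0
    zeros′ c c≤l′ = outside c (≤-trans c≤l′ l′≤l)
    low′ : ∀ c → T (inCol (g′ , l′) c) → (acc ⊕ (g , l)) c < entry r′ c
    low′ c t′ with c ≤? l
    -- The column begins in `r′`, so positivity of its entry suffices. Otherwise the cell above lies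
    -- in `r` and strict increase gives the bound.
    ... | yes c≤l rewrite outside c c≤l =
      at-All pos′ (subst (c ∸ l′ ∸ 1 <_) (sym fit′) (proj₁ (inCol-index g′ l′ c t′)))
    ... | no  c≰l = ≤-<-trans
      (≤-trans (+-monoʳ-≤ (acc c) (𝟙≤1 (inCol (g , l) c)))
        (≤-trans (≤-reflexive (+-comm (acc c) 1)) (low c t)))
      (increase c t t′)
      where t = inCol⁺ (g , l) (≰⇒> c≰l) (≤-trans (proj₂ (inCol⁻ (g′ , l′) {c} t′)) g′≤g)

sum-mono : ∀ {xs ys} → Pointwise _≤_ xs ys → sum xs ≤ sum ys
sum-mono []           = z≤n
sum-mono (x≤y ∷ rest) = +-mono-≤ x≤y (sum-mono rest)

+-tight : ∀ {a b c d} → a ≤ c → b ≤ d → c + d ≤ a + b → c ≤ a × d ≤ b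
+-tight {a} {b} {c} {d} a≤c b≤d le =
  +-cancelʳ-≤ d c a (≤-trans le (+-monoʳ-≤ a b≤d)) , +-cancelˡ-≤ c d b (≤-trans le (+-monoˡ-≤ b a≤c))

sum-tight : ∀ {xs ys} → Pointwise _≤_ xs ys → sum ys ≤ sum xs → xs ≡ ys
sum-tight []           _  = refl
sum-tight (x≤y ∷ rest) le with y≤x , le′ ← +-tight x≤y (sum-mono rest) le =
  cong₂ _∷_ (≤-antisym x≤y y≤x) (sum-tight rest le′)

sum-concat-mono : ∀ {xss yss} → Pointwise (Pointwise _≤_) xss yss → sum (concat xss) ≤ sum (concat yss)
sum-concat-mono []                                   = z≤n
sum-concat-mono (_∷_ {x = xs} {ys} {xss} {yss} xs≤ys rest)
  rewrite sum-++ xs (concat xss) | sum-++ ys (concat yss) =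
  +-mono-≤ (sum-mono xs≤ys) (sum-concat-mono rest)

sum-concat-tight : ∀ {xss yss} → Pointwise (Pointwise _≤_) xss yss →
  sum (concat yss) ≤ sum (concat xss) → xss ≡ yss
sum-concat-tight []           _  = refl
sum-concat-tight (_∷_ {x = xs} {ys} {xss} {yss} xs≤ys rest) le
  rewrite sum-++ xs (concat xss) | sum-++ ys (concat yss)
  with ys≤xs , le′ ← +-tight (sum-mono xs≤ys) (sum-concat-mono rest) le =
  cong₂ _∷_ (sum-tight xs≤ys ys≤xs) (sum-concat-tight rest le′)

-- Writing each entry as a weighted sum of indicators and exchanging the sums shows that the content
-- alone determines the sum of the entries.
content-sum : ∀ {mu word} → Content mu word → sum word ≡ ∑ (range 1 (length mu)) (λ a → a * part mu a)
content-sum {mu} {word} (bounds , count) = begin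
  sum word
    ≡⟨ cong sum (map-id word) ⟨
  ∑ word id
    ≡⟨ ∑-cong word (λ {v} v∈ → let 1≤v , v≤m = All.lookup bounds v∈ in ∑-δ id (length mu) v 1≤v v≤m) ⟨
  ∑ word (λ v → ∑ M (λ a → a * 𝟙 (v ≡ᵇ a)))
    ≡⟨ ∑-swap word M (λ v a → a * 𝟙 (v ≡ᵇ a)) ⟩
  ∑ M (λ a → ∑ word (λ v → a * 𝟙 (v ≡ᵇ a)))
    ≡⟨ ∑-cong M (λ {a} → weight a) ⟩
  ∑ M (λ a → a * part mu a) ∎
  where
  open ≡-Reasoning
  M = range 1 (length mu)
  weight : ∀ a → a ∈ M → ∑ word (λ v → a * 𝟙 (v ≡ᵇ a)) ≡ a * part mu a
  weight zero    a∈ = contradiction (proj₁ (∈-range⁻ a∈)) λ ()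
  weight (suc a) _  = trans (∑-*ˡ (suc a) word)
    (cong (suc a *_) (trans (sym (countᵇ-∑ (_≡ᵇ suc a) word)) (count a)))

-- By `content-sum` both fillings have the same total, so the cellwise inequality is an equality
-- everywhere.
canon-unique : ∀ {rs} → Linked _⊒_ (shape rs) →
  LRTableau (std (outer (shape rs)) (inner (shape rs))) rs →
  map proj₂ rs ≡ map proj₂ (canon (λ _ → 0) (shape rs))
canon-unique {rs} desc tab = sym (sum-concat-tight (least fits positive chain)
  (≤-reflexive (trans (content-sum {mu} content) (sym (content-sum {mu} (LRTableau.content (canon-LR desc)))))))
  where
  open LRTableau tab
  mu = std (outer (shape rs)) (inner (shape rs))
  positive : All (All (1 ≤_) ∘ proj₂) rs
  positive = All.map⁻ (All.concat⁻ (All.map proj₁ (proj₁ content)))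
  least : ∀ {rs} → All Fits rs → All (All (1 ≤_) ∘ proj₂) rs → Linked _above_ rs →
    Pointwise (Pointwise _≤_) (map proj₂ (canon (λ _ → 0) (shape rs))) (map proj₂ rs)
  least {[]}     _    _   _     = []
  least {r ∷ rs} fits@(fit ∷ _) pos@(pos₁ ∷ _) chain = canon-least (λ _ → 0) r rs fits pos chain
    (λ c t → at-All pos₁ (subst (c ∸ proj₂ (proj₁ r) ∸ 1 <_) (sym fit) (proj₁ (inCol-index _ _ c t))))
    (λ _ _ → refl)

-- Enumeration of fillings

-- Brings `words` and `fillings` into a form to which uniqueness and membership for cartesian
-- products apply.
concatMap-product : ∀ {C : Set} (f : A → B → C) xs ys →
  concatMap (λ x → map (f x) ys) xs ≡ cartesianProductWith f xs ys
concatMap-product f []       ys = refl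
concatMap-product f (x ∷ xs) ys = cong (map (f x) ys ++_) (concatMap-product f xs ys)

words-unique : ∀ L m → Unique (words L m)
words-unique zero    m = [] ∷ []
words-unique (suc L) m = subst Unique (sym (concatMap-product _∷_ (range 1 m) (words L m)))
  (Unique.cartesianProductWith⁺ _∷_ ∷-injective (range-unique m) (words-unique L m))

fillings-unique : ∀ Ls m → Unique (fillings Ls m)
fillings-unique []       m = [] ∷ []
fillings-unique (L ∷ Ls) m = subst Unique (sym (concatMap-product _∷_ (words L m) (fillings Ls m)))
  (Unique.cartesianProductWith⁺ _∷_ ∷-injective (words-unique L m) (fillings-unique Ls m))

∈-words : ∀ {m w} → All (λ a → 1 ≤ a × a ≤ m) w → w ∈ words (length w) m
∈-words []                                 = here refl
∈-words {m} {x ∷ w} ((1≤x , x≤m) ∷ inside) =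
  subst (x ∷ w ∈_) (sym (concatMap-product _∷_ (range 1 m) (words (length w) m)))
    (∈-cartesianProductWith⁺ _∷_ (∈-range⁺ 1≤x x≤m) (∈-words inside))

∈-fillings : ∀ {m ws} → All (All (λ a → 1 ≤ a × a ≤ m)) ws → ws ∈ fillings (map length ws) m
∈-fillings []                          = here refl
∈-fillings {m} {w ∷ ws} (row ∷ inside) =
  subst (w ∷ ws ∈_) (sym (concatMap-product _∷_ (words (length w) m) (fillings (map length ws) m)))
    (∈-cartesianProductWith⁺ _∷_ (∈-words row) (∈-fillings inside))

fits-lengths : ∀ {rs} → All Fits rs →
  map length (map proj₂ rs) ≡ rowLengths (outer (shape rs)) (inner (shape rs))
fits-lengths []           = refl
fits-lengths (fit ∷ fits) = cong₂ _∷_ fit (fits-lengths fits)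

-- The count is at most 1 because the enumeration has no repetitions and every filling that passes
-- is canonical; it is at least 1 because the canonical filling is enumerated and passes.
unique-LR : ∀ sh → Linked _⊒_ sh → let mu = std (outer sh) (inner sh) in
  countᵇ (isLRᵇ (outer sh) (inner sh) mu) (fillings (rowLengths (outer sh) (inner sh)) (length mu)) ≡ 1
unique-LR sh desc = ≤-antisym
  (countᵇ≤1 (fillings-unique (rowLengths (outer sh) (inner sh)) (length mu))
    (λ t t′ → trans (is-canon t) (sym (is-canon t′))))
  (countᵇ-some member test)
  where
  mu = std (outer sh) (inner sh)
  R  = canon (λ _ → 0) sh
  tab = canon-LR desc
  is-canon : ∀ {ws} → T (isLRᵇ (outer sh) (inner sh) mu ws) → ws ≡ map proj₂ R
  is-canon t with rs , refl , refl , tab ← isLRᵇ⁻ {mu = mu} desc t = canon-unique desc tab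
  member : map proj₂ R ∈ fillings (rowLengths (outer sh) (inner sh)) (length mu)
  member = subst (λ Ls → map proj₂ R ∈ fillings Ls (length mu))
    (trans (fits-lengths (LRTableau.fits tab))
      (cong (λ sh → rowLengths (outer sh) (inner sh)) (shape-canon (λ _ → 0) sh)))
    (∈-fillings (All.concat⁻ (proj₁ (LRTableau.content tab))))
  test : T (isLRᵇ (outer sh) (inner sh) mu (map proj₂ R))
  test = subst (λ sh → T (isLRᵇ (outer sh) (inner sh) mu (map proj₂ R)))
    (shape-canon (λ _ → 0) sh) (isLRᵇ⁺ tab)

-- Padding and row deletion as list operations

-- pad and delRows are defined through local functions that cannot be named from outside;
-- the metavariables below are solved by those functions.

mutual
  padTail : ℕ → List ℕ → List ℕ → List ℕ → List ℕ
  padTail = _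

  pad-∷ : ∀ n x xs → pad n (x ∷ xs) ≡ x ∷ padTail n (x ∷ xs) xs (replicate (n ∸ suc (length xs)) 0)
  -- Abstracting these arguments to variables makes the unification problem a pattern with a unique
  -- solution.
  pad-∷ n x xs with x ∷ xs | replicate (n ∸ suc (length xs)) 0
  ... | _ | _ = refl

padTail-++ : ∀ n la xs ys → padTail n la xs ys ≡ xs ++ ys
padTail-++ n la []       ys = refl
padTail-++ n la (x ∷ xs) ys = cong (x ∷_) (padTail-++ n la xs ys)

pad-++ : ∀ n la → pad n la ≡ la ++ replicate (n ∸ length la) 0
pad-++ n []       = refl
pad-++ n (x ∷ la) = cong (x ∷_) (padTail-++ n (x ∷ la) la _)

mutual
  delFrom : List ℕ → List ℕ → ℕ → List ℕ → List ℕ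
  delFrom = _

  delRows-∷ : ∀ I x xs → delRows I (x ∷ xs) ≡
    (if hit I 1 then delFrom I (x ∷ xs) 2 xs else x ∷ delFrom I (x ∷ xs) 2 xs)
  delRows-∷ I x xs with hit I 1 | 2 | x ∷ xs
  ... | _ | _ | _ = refl

delFrom-keep : ∀ I zs p xs → delFrom I zs p xs ≡ keep (hit I) p xs
delFrom-keep I zs p []       = refl
delFrom-keep I zs p (x ∷ xs) with hit I p
... | true  = delFrom-keep I zs (suc p) xs
... | false = cong (x ∷_) (delFrom-keep I zs (suc p) xs)

delRows-keep : ∀ I xs → delRows I xs ≡ keep (hit I) 1 xs
delRows-keep I []       = refl
delRows-keep I (x ∷ xs) = delFrom-keep I (x ∷ xs) 1 (x ∷ xs)

delRows-map : ∀ I (f : ℕ × ℕ → ℕ) sh → delRows I (map f sh) ≡ map f (keep (hit I) 1 sh)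
delRows-map I f sh = trans (delRows-keep I (map f sh)) (keep-map (hit I) 1 f sh)

keep-all : ∀ p (xs : List A) → keep (hit []) p xs ≡ xs
keep-all p []       = refl
keep-all p (x ∷ xs) = cong (x ∷_) (keep-all (suc p) xs)

length-pad : ∀ n la → length la ≤ n → length (pad n la) ≡ n
length-pad n la le = begin
  length (pad n la)                              ≡⟨ cong length (pad-++ n la) ⟩
  length (la ++ replicate (n ∸ length la) 0)     ≡⟨ length-++ la ⟩
  length la + length (replicate (n ∸ length la) 0) ≡⟨ cong (length la +_) (length-replicate (n ∸ length la)) ⟩
  length la + (n ∸ length la)                    ≡⟨ m+[n∸m]≡n le ⟩
  n ∎
  where open ≡-Reasoning

pad-descending : ∀ n {la} → Linked _≥_ la → Linked _≥_ (pad n la)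
pad-descending n {la} desc = subst (Linked _≥_) (sym (pad-++ n la)) (append desc (n ∸ length la))
  where
  zeros : ∀ k → Linked _≥_ (replicate k 0)
  zeros zero          = []
  zeros (suc zero)    = [-]
  zeros (suc (suc k)) = z≤n ∷ zeros (suc k)
  append : ∀ {xs} → Linked _≥_ xs → ∀ k → Linked _≥_ (xs ++ replicate k 0)
  append []          k       = zeros k
  append [-]         zero    = [-]
  append [-]         (suc k) = z≤n ∷ zeros (suc k)
  append (y≤x ∷ desc) k      = y≤x ∷ append desc k

-- Assembly: from lists of pairs to the given partitions

unzip-rows : ∀ xs ys → length xs ≡ length ys → ∃ λ sh → outer sh ≡ xs × inner sh ≡ ys
unzip-rows []       []       _  = [] , refl , refl
unzip-rows (x ∷ xs) (y ∷ ys) eq with sh , refl , refl ← unzip-rows xs ys (suc-injective eq) =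
  (x , y) ∷ sh , refl , refl

-- The conclusion is stated as a family over two lists of bounds, so that it can be transported from
-- an unzipped shape to `ga` and the padded `la`.
Maximality : List ℕ → List ℕ → Set
Maximality g l =
  ((mu : List ℕ) → IsPartition mu → coeff mu ≢ 0 →
    (mu ≤GDom std g l)
    × ((I : List ℕ) → 1 ≤ length I → length I ≤ length g → IncSeq (length g) I →
        drop (length I) mu ≤GDom std (delRows I g) (delRows I l)))
  × (coeff (std g l) ≡ 1)
  where
  coeff : List ℕ → ℕ
  coeff mu = countᵇ (isLRᵇ g l mu) (fillings (rowLengths g l) (length mu))

maximality : ∀ sh → Linked _⊒_ sh → Maximality (outer sh) (inner sh)
maximality sh desc = bounds , unique-LR sh desc
  where
  deletion : ∀ {mu ws} → Linked _≥_ mu → T (isLRᵇ (outer sh) (inner sh) mu ws) → ∀ I →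
    let sh′ = keep (hit I) 1 sh in drop (length I) mu ≤GDom std (outer sh′) (inner sh′)
  deletion {mu} {ws} desc-mu t I with rs , refl , _ , tab ← isLRᵇ⁻ {mu = mu} {ws} desc t =
    dominated desc-mu tab I
  bounds : ∀ mu → _ → _ → _
  bounds mu (desc-mu , _) ≢0 with ws , t ← countᵇ-witness _ (fillings (rowLengths (outer sh) (inner sh)) (length mu)) ≢0 =
    -- The bound by `∂⁰` is the case in which no row is deleted.
    subst (λ sh → mu ≤GDom std (outer sh) (inner sh)) (keep-all 1 sh) (deletion {ws = ws} desc-mu t []) ,
    λ I _ _ _ → subst (drop (length I) mu ≤GDom_)
      (sym (cong₂ std (delRows-map I proj₁ sh) (delRows-map I proj₂ sh))) (deletion {ws = ws} desc-mu t I)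

theorem4p1 : (ga la : List ℕ) → IsPartition ga → IsPartition la → la ⊆ₚ ga →
    ((mu : List ℕ) → IsPartition mu → LRcoeff ga la mu ≢ 0 →
    (mu ≤GDom ∂⁰ ga la)
    × ((I : List ℕ) → 1 ≤ length I → length I ≤ length ga → IncSeq (length ga) I →
    drop (length I) mu ≤GDom ∂ I ga la))
    × (LRcoeff ga la (∂⁰ ga la) ≡ 1)
theorem4p1 ga la (desc-ga , _) (desc-la , _) (la≤ga , _)
  with sh , eq₁ , eq₂ ← unzip-rows ga (pad (length ga) la) (sym (length-pad (length ga) la la≤ga)) =
  subst₂ Maximality eq₁ eq₂ (maximality sh (Linked.zip
    ( Linked.map⁻ (subst (Linked _≥_) (sym eq₁) desc-ga)
    , Linked.map⁻ (subst (Linked _≥_) (sym eq₂) (pad-descending (length ga) desc-la)))))
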